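{- Let $p$ be an odd prime, $n\ge 1$ an integer, and $L$ the finite field with $q=p^{2n}$ elements. Let $s$ be an invertible Niho exponent over $L$. Then $s$ is singular, i.e. there exists $a\in L^\times$ with $W_{L,s}(a)=0$.
   Context: For $x\in L$ let $\mu(x)=e^{2\pi i\,\mathrm{Tr}_{L/\mathbb{F}_p}(x)/p}$ be the canonical additive character of $L$, where $\mathrm{Tr}_{L/\mathbb{F}_p}$ is the absolute trace. For a positive integer $s$ and $a\in L$, the Weil sum is $W_{L,s}(a)=\sum_{x\in L}\mu(x^s-ax)$. The exponent $s$ is invertible over $L$ if $\gcd(s,p^{2n}-1)=1$. A Niho exponent over $L$ (of order $p^{2n}$) is an integer $s$ that is not congruent to a power of $p$ modulo $p^{2n}-1$ but satisfies $s\equiv p^j \pmod{p^n-1}$ for some integer $j\ge 0$. -}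

module Defs where

open import Data.Nat as ℕ using (ℕ; zero; suc; _∸_)
open import Data.Nat.GCD using (gcd)
open import Data.Fin using (Fin)
open import Data.Fin.Properties using (_≟_)
open import Data.List using (List; foldr; upTo; allFin; filter; length)
open import Data.Integer as ℤ using (ℤ; +_)
open import Data.Integer.Divisibility as ℤD using ()
open import Data.Product using (∃; _×_)
open import Relation.Binary.PropositionalEquality using (_≡_; _≢_)
open import Relation.Nullary using (¬_)
open import Algebra.Structures using (IsCommutativeRing)

-- A finite field with exactly q elements, realised on the carrier Fin q
-- (every finite field of order q is isomorphic to one of these).
record FiniteField (q : ℕ) : Set where
  infixl 6 _+_
  infixl 7 _*_
  field
    _+_ _*_ : Fin q → Fin q → Fin q
    -_      : Fin q → Fin q
    0# 1#   : Fin q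
    isCommutativeRing : IsCommutativeRing _≡_ _+_ _*_ -_ 0# 1#
    0≢1     : 0# ≢ 1#
    inverse : ∀ x → x ≢ 0# → ∃ λ y → x * y ≡ 1#

  _-_ : Fin q → Fin q → Fin q
  x - y = x + (- y)

  _^_ : Fin q → ℕ → Fin q
  x ^ zero = 1#
  x ^ suc k = x * (x ^ k)

  natF : ℕ → Fin q
  natF zero = 0#
  natF (suc k) = 1# + natF k

  sumF : List (Fin q) → Fin q
  sumF = foldr _+_ 0#

Tr : ∀ {q} → FiniteField q → (p m : ℕ) → Fin q → Fin q
Tr F p m x = sumF (Data.List.map (λ i → x ^ (p ℕ.^ i)) (upTo m))
  where open FiniteField F

-- The Weil sum W_{L,s}(a) = Σ_x ζ_p^{Tr(x^s - a x)} as an element of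
-- ℤ[ζ_p] ≅ ℤ[X]/(1 + X + ... + X^{p-1}), represented by its coefficient
-- vector with respect to 1, ζ_p, ..., ζ_p^{p-1}:
-- coefficient k = #{ x ∈ L : Tr(x^s - a x) = k·1 }.
weilCoeffs : ∀ {q} → FiniteField q → (p m s : ℕ) → Fin q → ℕ → ℕ
weilCoeffs F p m s a k =
  length (filter (λ x → Tr F p m ((x ^ s) - (a * x)) ≟ natF k) (allFin _))
  where open FiniteField F

-- An element Σ_{k<p} c_k ζ_p^k of ℤ[ζ_p] (degree < p representative) is zero
-- iff it is an integer multiple of 1 + X + ... + X^{p-1}, i.e. all c_k agree.
IsZeroCyc : (p : ℕ) → (ℕ → ℕ) → Set
IsZeroCyc p c = ∃ λ λ₀ → ∀ k → k ℕ.< p → c k ≡ λ₀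

WeilZero : ∀ {q} → FiniteField q → (p m s : ℕ) → Fin q → Set
WeilZero F p m s a = IsZeroCyc p (weilCoeffs F p m s a)

_≡_[mod_] : ℕ → ℕ → ℕ → Set
a ≡ b [mod m ] = (+ m) ℤD.∣ ((+ a) ℤ.- (+ b))

IsNiho : (p n s : ℕ) → Set
IsNiho p n s =
  (∀ j → ¬ (s ≡ p ℕ.^ j [mod (p ℕ.^ (2 ℕ.* n) ∸ 1) ]))
  × ∃ λ j → s ≡ p ℕ.^ j [mod (p ℕ.^ n ∸ 1) ]

IsInvertible : (p n s : ℕ) → Set
IsInvertible p n s = gcd s (p ℕ.^ (2 ℕ.* n) ∸ 1) ≡ 1

{-# OPTIONS --safe #-}
module Submission where

-- Let Q = p^n, σ x = x^Q, K the fixed field of σ and T x = x + σ x, so that the absolute trace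
-- factors through T. Replacing x^s by g x = (x^s)^(p^k) for a suitable k changes no trace and makes g
-- homogeneous over K, so h_a(x) = T (g x - a x) is homogeneous as well, and for x ≠ 0 the set
-- A_x = { a | h_a(x) = 0 } is an affine K-line in the plane L which depends only on K x.
-- These lines have pairwise distinct directions, and since g is bijective, 0 lies on exactly one of
-- them, A_{x₀}. The |K| other lines meet A_{x₀} in its |K| - 1 nonzero points, so two of them meet it in
-- a common point a. On one of these two, say A_x, the |K| lines other than A_x cut out at most
-- |K| - 1 points, so some b on A_x lies on no other line, and b ≠ 0.
-- For this b the zeros of h_b are just K x, hence all fibres of h_b : L → K have |K| elements, as for T:
-- h_b = T ∘ Ψ for a bijection Ψ of L. So the coefficients of W(b) count the values of the trace
-- itself, which is additive and onto the prime field.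

open import Defs
open import Algebra.Bundles using (CommutativeRing)
open import Data.Bool using (true; false; if_then_else_)
open import Data.Fin using (Fin; zero; suc; punchIn; punchOut; inject≤; fromℕ; inject₁)
open import Data.Fin.Permutation using (Permutation; permutation)
open import Data.Fin.Properties using (_≟_; any?; all?; ¬∀⟶∃¬; punchOut-injective; punchInᵢ≢i; pigeonhole; <⇒≢; inject≤-injective; suc-injective; toℕ<n; toℕ-inject₁; toℕ-fromℕ)
open import Data.Integer as ℤ using (ℤ; +_; -[1+_]; _⊖_)
import Data.Integer.Properties as ℤ
open import Data.List using (applyUpTo; allFin; filter; length; tabulate)
open import Data.List.Properties using (map-upTo)
open import Data.Nat as ℕ using (ℕ; zero; suc; _∸_; s≤s; z≤n)
import Data.Nat.Properties as ℕ
open import Data.Product using (∃; ∃₂; _×_; _,_; proj₁; proj₂)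
open import Data.Sum using (inj₁; inj₂)
open import Data.Vec.Functional using (replicate)
open import Function using (_∘_; id)
open import Function.Bundles using (mk⇔)
open import Function.Definitions using (Injective)
open import Level using (0ℓ)
open import Relation.Binary.PropositionalEquality using (_≡_; _≢_; refl; sym; trans; cong; cong₂; subst; module ≡-Reasoning)
open import Relation.Nullary using (¬_; Dec; yes; no; does; contradiction)
open import Relation.Nullary.Decidable using (does-⇔)
open import Relation.Unary using (Pred; Decidable)

-- Self-maps of finite sets: missed values and collisions

-- Deleting the missed value `y` from the codomain leaves one point fewer than in the domain, so the
-- pigeonhole principle applies.
missed⇒collision : ∀ {n} (f : Fin n → Fin n) y → (∀ x → f x ≢ y) → ∃₂ λ i j → i ≢ j × f i ≡ f j
missed⇒collision {suc n} f y missed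
  with i , j , i<j , eq ← pigeonhole (ℕ.n<1+n n) (λ x → punchOut (missed x ∘ sym))
  = i , j , <⇒≢ i<j , punchOut-injective (missed i ∘ sym) (missed j ∘ sym) eq

injective⇒surjective : ∀ {n} (f : Fin n → Fin n) → Injective _≡_ _≡_ f → ∀ y → ∃ λ x → f x ≡ y
injective⇒surjective f inj y with any? (λ x → f x ≟ y)
... | yes hit = hit
... | no none with i , j , i≢j , eq ← missed⇒collision f y (λ x eq → none (x , eq))
  = contradiction (inj eq) i≢j

-- Were `f` onto, a choice of preimages would be injective and hence onto. Then `i` and `j` are both
-- chosen preimages, and `f i ≡ f j` makes them preimages chosen for the same point.
collision⇒missed : ∀ {n} (f : Fin n → Fin n) {i j} → i ≢ j → f i ≡ f j → ∃ λ y → ∀ x → f x ≢ y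
collision⇒missed {n} f {i} {j} i≢j eq with all? (λ y → any? (λ x → f x ≟ y))
... | no ¬surj with y , none ← ¬∀⟶∃¬ n _ (λ y → any? (λ x → f x ≟ y)) ¬surj
  = y , λ x eq → none (x , eq)
... | yes surj = contradiction i≡j i≢j
  where
  section : Fin n → Fin n
  section y = proj₁ (surj y)
  section-injective : Injective _≡_ _≡_ section
  section-injective {y} {z} eq = trans (sym (proj₂ (surj y))) (trans (cong f eq) (proj₂ (surj z)))
  i≡j : i ≡ j
  i≡j with a , refl ← injective⇒surjective section section-injective i
      with b , refl ← injective⇒surjective section section-injective j
    = cong section (trans (sym (proj₂ (surj a))) (trans eq (proj₂ (surj b))))

-- Reduced to self-maps of Fin n by letting f act as the identity outside P.
module Subset {n ℓ} {P : Pred (Fin n) ℓ} (P? : Decidable P) (f : Fin n → Fin n)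
  (f-closed : ∀ {x} → P x → P (f x)) where

  private
    extend : Fin n → Fin n
    extend x with P? x
    ... | yes _ = f x
    ... | no  _ = x

    extend-in : ∀ {x} → P x → extend x ≡ f x
    extend-in {x} px with P? x
    ... | yes _  = refl
    ... | no ¬px = contradiction px ¬px

    extend-out : ∀ {x} → ¬ P x → extend x ≡ x
    extend-out {x} ¬px with P? x
    ... | yes px = contradiction px ¬px
    ... | no _   = refl

  missed⇒collision-on : ∀ {y} → P y → (∀ {x} → P x → f x ≢ y) →
    ∃₂ λ i j → P i × P j × i ≢ j × f i ≡ f j
  missed⇒collision-on {y} py missed with missed⇒collision extend y avoid
    where
    avoid : ∀ x → extend x ≢ y
    avoid x with P? x
    ... | yes px = missed px
    ... | no ¬px = λ x≡y → ¬px (subst P (sym x≡y) py)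
  ... | i , j , i≢j , eq with P? i | P? j
  ... | yes pi | yes pj = i , j , pi , pj , i≢j , eq
  -- A point outside `P` is its own image, so it cannot share its image with a point of `P`.
  ... | yes pi | no ¬pj = contradiction (subst P eq (f-closed pi)) ¬pj
  ... | no ¬pi | yes pj = contradiction (subst P (sym eq) (f-closed pj)) ¬pi
  ... | no ¬pi | no ¬pj = contradiction eq i≢j

  collision⇒missed-on : ∀ {i j} → P i → P j → i ≢ j → f i ≡ f j →
    ∃ λ y → P y × (∀ {x} → P x → f x ≢ y)
  collision⇒missed-on pi pj i≢j eq
    with y , missed ← collision⇒missed extend i≢j (trans (extend-in pi) (trans eq (sym (extend-in pj))))
    with P? y
  ... | yes py = y , py , λ px fx≡y → missed _ (trans (extend-in px) fx≡y)
  ... | no ¬py = contradiction (extend-out ¬py) (missed y)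

injective⇒permutation : ∀ {n} (f : Fin n → Fin n) → Injective _≡_ _≡_ f → Permutation n n
injective⇒permutation f inj = permutation f (proj₁ ∘ surj) (proj₂ ∘ surj) (λ x → inj (proj₂ (surj (f x))))
  where surj = injective⇒surjective f inj

-- Counting solutions

private
  module Σℕ where
    open import Algebra.Properties.CommutativeMonoid.Sum ℕ.+-0-commutativeMonoid public

  -- As a sum of indicators a count can be reindexed along a permutation.
  length-filter-tabulate : ∀ {n a p} {A : Set a} {P : Pred A p} (P? : Decidable P) (f : Fin n → A) →
    length (filter P? (tabulate f)) ≡ Σℕ.sum (λ i → if does (P? (f i)) then 1 else 0)
  length-filter-tabulate {zero}  P? f = refl
  length-filter-tabulate {suc n} P? f with does (P? (f zero))
  ... | true  = cong suc (length-filter-tabulate P? (f ∘ suc))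
  ... | false = length-filter-tabulate P? (f ∘ suc)

count-reindex : ∀ {n p q} {P : Pred (Fin n) p} {Q : Pred (Fin n) q} (P? : Decidable P) (Q? : Decidable Q)
  (f : Fin n → Fin n) → Injective _≡_ _≡_ f →
  (∀ {x} → P x → Q (f x)) → (∀ {x} → Q (f x) → P x) →
  length (filter P? (allFin n)) ≡ length (filter Q? (allFin n))
count-reindex {n} P? Q? f inj P⇒Q Q⇒P = begin
  length (filter P? (allFin n))                       ≡⟨ length-filter-tabulate P? id ⟩
  Σℕ.sum (λ i → if does (P? i) then 1 else 0)         ≡⟨ Σℕ.sum-cong-≗ (λ i → cong (λ b → if b then 1 else 0) (does-⇔ (mk⇔ P⇒Q Q⇒P) (P? i) (Q? (f i)))) ⟩
  Σℕ.sum (λ i → if does (Q? (f i)) then 1 else 0)     ≡⟨ Σℕ.sum-permute _ (injective⇒permutation f inj) ⟨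
  Σℕ.sum (λ i → if does (Q? i) then 1 else 0)         ≡⟨ length-filter-tabulate Q? id ⟨
  length (filter Q? (allFin n))                       ∎
  where open ≡-Reasoning

-- Ring normalisation

-- Coefficients in ℤ rather than in R, so that the normaliser can decide when terms cancel.
module IntegerRingSolver {c ℓ} (R : CommutativeRing c ℓ) where
  open CommutativeRing R using (Carrier; _≈_; _+_; _*_; -_; 0#; 1#; +-congˡ; +-congʳ; -‿cong; setoid; semiring; ring; +-abelianGroup; +-identityˡ; +-identityʳ; +-assoc; +-comm; -‿inverseʳ)
    renaming (refl to ≈-refl; sym to ≈-sym; trans to ≈-trans; reflexive to ≈-reflexive)
  open import Algebra.Properties.Semiring.Mult semiring using (×-homo-+; ×1-homo-*) renaming (_×_ to _·_)
  open import Algebra.Properties.Ring ring using (-‿distribˡ-*; -‿distribʳ-*; -‿involutive; -0#≈0#)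
  open import Algebra.Properties.AbelianGroup +-abelianGroup using (⁻¹-∙-comm)
  open import Algebra.Solver.Ring.AlmostCommutativeRing
  open import Relation.Binary.Reasoning.Setoid setoid
  open import Relation.Binary.Consequences using (dec⇒weaklyDec)
  open import Data.Maybe using (map)

  private
    ⟦_⟧ᶻ : ℤ → Carrier
    ⟦ + n ⟧ᶻ      = n · 1#
    ⟦ -[1+ n ] ⟧ᶻ = - (suc n · 1#)

    ⊖-homo : ∀ m n → ⟦ m ⊖ n ⟧ᶻ ≈ m · 1# + - (n · 1#)
    ⊖-homo m zero = ≈-sym (≈-trans (+-congˡ -0#≈0#) (+-identityʳ _))
    ⊖-homo zero (suc n) = ≈-sym (+-identityˡ _)
    ⊖-homo (suc m) (suc n) = begin
      ⟦ suc m ⊖ suc n ⟧ᶻ                   ≈⟨ ≈-reflexive (cong ⟦_⟧ᶻ (ℤ.[1+m]⊖[1+n]≡m⊖n m n)) ⟩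
      ⟦ m ⊖ n ⟧ᶻ                           ≈⟨ ⊖-homo m n ⟩
      m′ + - n′                            ≈⟨ +-congʳ (+-identityˡ m′) ⟨
      (0# + m′) + - n′                     ≈⟨ +-congʳ (+-congʳ (-‿inverseʳ 1#)) ⟨
      ((1# + - 1#) + m′) + - n′            ≈⟨ +-congʳ (≈-trans (+-assoc _ _ _) (≈-trans (+-congˡ (+-comm _ _)) (≈-sym (+-assoc _ _ _)))) ⟩
      ((1# + m′) + - 1#) + - n′            ≈⟨ +-assoc _ _ _ ⟩
      (1# + m′) + (- 1# + - n′)            ≈⟨ +-congˡ (⁻¹-∙-comm _ _) ⟩
      suc m · 1# + - (suc n · 1#)          ∎
      where m′ = m · 1# ; n′ = n · 1#

    -‿homo : ∀ i → ⟦ ℤ.- i ⟧ᶻ ≈ - ⟦ i ⟧ᶻ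
    -‿homo (+ zero)  = ≈-sym -0#≈0#
    -‿homo (+ suc n) = ≈-refl
    -‿homo -[1+ n ]  = ≈-sym (-‿involutive _)

    +-homo : ∀ i j → ⟦ i ℤ.+ j ⟧ᶻ ≈ ⟦ i ⟧ᶻ + ⟦ j ⟧ᶻ
    +-homo (+ m)    (+ n)    = ×-homo-+ 1# m n
    +-homo (+ m)    -[1+ n ] = ⊖-homo m (suc n)
    +-homo -[1+ m ] (+ n)    = ≈-trans (⊖-homo n (suc m)) (+-comm _ _)
    +-homo -[1+ m ] -[1+ n ] = begin
      - (suc (suc (m ℕ.+ n)) · 1#)       ≈⟨ ≈-reflexive (cong (λ k → - (suc k · 1#)) (sym (ℕ.+-suc m n))) ⟩
      - ((suc m ℕ.+ suc n) · 1#)         ≈⟨ -‿cong (×-homo-+ 1# (suc m) (suc n)) ⟩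
      - (suc m · 1# + suc n · 1#)        ≈⟨ ⁻¹-∙-comm _ _ ⟨
      - (suc m · 1#) + - (suc n · 1#)    ∎

    *-homo⁺ : ∀ m j → ⟦ + m ℤ.* j ⟧ᶻ ≈ ⟦ + m ⟧ᶻ * ⟦ j ⟧ᶻ
    *-homo⁺ m (+ n) = ≈-trans (≈-reflexive (cong ⟦_⟧ᶻ (sym (ℤ.pos-* m n)))) (×1-homo-* m n)
    *-homo⁺ m -[1+ n ] = begin
      ⟦ + m ℤ.* -[1+ n ] ⟧ᶻ           ≈⟨ ≈-reflexive (cong ⟦_⟧ᶻ (sym (ℤ.neg-distribʳ-* (+ m) (+ suc n)))) ⟩
      ⟦ ℤ.- (+ m ℤ.* + suc n) ⟧ᶻ      ≈⟨ -‿homo (+ m ℤ.* + suc n) ⟩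
      - ⟦ + m ℤ.* + suc n ⟧ᶻ          ≈⟨ -‿cong (*-homo⁺ m (+ suc n)) ⟩
      - (m · 1# * (suc n · 1#))       ≈⟨ -‿distribʳ-* _ _ ⟩
      m · 1# * - (suc n · 1#)         ∎

    *-homo : ∀ i j → ⟦ i ℤ.* j ⟧ᶻ ≈ ⟦ i ⟧ᶻ * ⟦ j ⟧ᶻ
    *-homo (+ m) j = *-homo⁺ m j
    *-homo -[1+ m ] j = begin
      ⟦ -[1+ m ] ℤ.* j ⟧ᶻ             ≈⟨ ≈-reflexive (cong ⟦_⟧ᶻ (sym (ℤ.neg-distribˡ-* (+ suc m) j))) ⟩
      ⟦ ℤ.- (+ suc m ℤ.* j) ⟧ᶻ        ≈⟨ -‿homo (+ suc m ℤ.* j) ⟩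
      - ⟦ + suc m ℤ.* j ⟧ᶻ            ≈⟨ -‿cong (*-homo⁺ (suc m) j) ⟩
      - (suc m · 1# * ⟦ j ⟧ᶻ)         ≈⟨ -‿distribˡ-* _ _ ⟩
      - (suc m · 1#) * ⟦ j ⟧ᶻ         ∎

    morphism : ℤ.+-*-rawRing -Raw-AlmostCommutative⟶ fromCommutativeRing R
    morphism = record
      { ⟦_⟧    = ⟦_⟧ᶻ
      ; +-homo = +-homo
      ; *-homo = *-homo
      ; -‿homo = -‿homo
      ; 0-homo = ≈-refl
      ; 1-homo = +-identityʳ 1#
      }

  open import Algebra.Solver.Ring ℤ.+-*-rawRing (fromCommutativeRing R) morphism
    (λ i j → map (λ i≡j → ≈-reflexive (cong ⟦_⟧ᶻ i≡j)) (dec⇒weaklyDec ℤ._≟_ i j)) public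
    using (con; solve; _:=_; _:+_; _:*_; _:-_; :-_)

-- Arithmetic of a finite field

module FieldProperties {q} (F : FiniteField q) where

  private module F = FiniteField F

  commutativeRing : CommutativeRing 0ℓ 0ℓ
  commutativeRing = record { isCommutativeRing = F.isCommutativeRing }

  open CommutativeRing commutativeRing public
    using (_+_; _*_; -_; _-_; 0#; 1#; +-assoc; +-comm; +-identityˡ; +-identityʳ; *-assoc; *-comm; *-identityˡ; *-identityʳ;
           distribˡ; zeroˡ; zeroʳ; -‿inverseʳ; *-commutativeMonoid; +-commutativeMonoid; commutativeSemiring; semiring; +-group; +-monoid; ring)
  open import Algebra.Properties.CommutativeSemiring.Exp commutativeSemiring public
    using (_^_; ^-homo-*; ^-assocʳ; ^-distrib-*)
  open import Algebra.Properties.Semiring.Mult semiring public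
    using (×1-homo-*; ×-assoc-*) renaming (_×_ to _·_)
  open import Algebra.Properties.Group +-group public
    using () renaming (x∙y⁻¹≈ε⇒x≈y to x-y≡0⇒x≡y; x≈y⇒x∙y⁻¹≈ε to x≡y⇒x-y≡0; ∙-cancelˡ to +-cancelˡ; ∙-cancelʳ to +-cancelʳ)
  open import Algebra.Properties.Ring ring public using (-0#≈0#)
  open IntegerRingSolver commutativeRing public
  open ≡-Reasoning

  infix 9 _⁻¹

  -- Total, with the default value `0#` at `0#`, so that formulas need no nonvanishing argument.
  _⁻¹ : Fin q → Fin q
  x ⁻¹ with x ≟ 0#
  ... | yes _  = 0#
  ... | no x≢0 = proj₁ (F.inverse x x≢0)

  ⁻¹-inverseʳ : ∀ {x} → x ≢ 0# → x * x ⁻¹ ≡ 1#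
  ⁻¹-inverseʳ {x} x≢0 with x ≟ 0#
  ... | yes x≡0 = contradiction x≡0 x≢0
  ... | no x≢0′ = proj₂ (F.inverse x x≢0′)

  0≢1 : 0# ≢ 1#
  0≢1 = F.0≢1

  *-cancelˡ : ∀ {x y z} → x ≢ 0# → x * y ≡ x * z → y ≡ z
  *-cancelˡ {x} {y} {z} x≢0 eq = trans (sym (lemma y)) (trans (cong (x ⁻¹ *_) eq) (lemma z))
    where
    lemma : ∀ y → x ⁻¹ * (x * y) ≡ y
    lemma y = begin
      x ⁻¹ * (x * y) ≡⟨ *-assoc _ _ _ ⟨
      (x ⁻¹ * x) * y ≡⟨ cong (_* y) (trans (*-comm _ _) (⁻¹-inverseʳ x≢0)) ⟩
      1# * y         ≡⟨ *-identityˡ y ⟩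
      y              ∎

  x*y≡0⇒y≡0 : ∀ {x y} → x ≢ 0# → x * y ≡ 0# → y ≡ 0#
  x*y≡0⇒y≡0 {x} x≢0 xy≡0 = *-cancelˡ x≢0 (trans xy≡0 (sym (zeroʳ x)))

  *-≢0 : ∀ {x y} → x ≢ 0# → y ≢ 0# → x * y ≢ 0#
  *-≢0 x≢0 y≢0 xy≡0 = y≢0 (x*y≡0⇒y≡0 x≢0 xy≡0)

  ⁻¹-≢0 : ∀ {x} → x ≢ 0# → x ⁻¹ ≢ 0#
  ⁻¹-≢0 {x} x≢0 x⁻¹≡0 = 0≢1 (begin
    0#         ≡⟨ zeroʳ x ⟨
    x * 0#     ≡⟨ cong (x *_) x⁻¹≡0 ⟨
    x * x ⁻¹   ≡⟨ ⁻¹-inverseʳ x≢0 ⟩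
    1#         ∎)

  1^n≡1 : ∀ n → 1# ^ n ≡ 1#
  1^n≡1 zero    = refl
  1^n≡1 (suc n) = trans (*-identityˡ _) (1^n≡1 n)

  0^n≡0 : ∀ {n} → n ≢ 0 → 0# ^ n ≡ 0#
  0^n≡0 {zero}  n≢0 = contradiction refl n≢0
  0^n≡0 {suc n} _   = zeroˡ _

  ^-≢0 : ∀ {x} n → x ≢ 0# → x ^ n ≢ 0#
  ^-≢0 zero    x≢0 = 0≢1 ∘ sym
  ^-≢0 (suc n) x≢0 = *-≢0 x≢0 (^-≢0 n x≢0)

  ^-comm : ∀ x m n → (x ^ m) ^ n ≡ (x ^ n) ^ m
  ^-comm x m n = trans (^-assocʳ x m n) (trans (cong (x ^_) (ℕ.*-comm m n)) (sym (^-assocʳ x n m)))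

  ^-agrees : ∀ x n → x F.^ n ≡ x ^ n
  ^-agrees x zero    = refl
  ^-agrees x (suc n) = cong (x *_) (^-agrees x n)

  natF-agrees : ∀ n → F.natF n ≡ n · 1#
  natF-agrees zero    = refl
  natF-agrees (suc n) = cong (_+_ 1#) (natF-agrees n)

  private
    -- Sums in the multiplicative monoid: `Π.sum` is a product.
    module Π where
      open import Algebra.Properties.CommutativeMonoid.Sum *-commutativeMonoid public
    module Σ where
      open import Algebra.Properties.CommutativeMonoid.Sum +-commutativeMonoid public

    Π-≢0 : ∀ {n} (f : Fin n → Fin q) → (∀ i → f i ≢ 0#) → Π.sum f ≢ 0#
    Π-≢0 {zero}  f f≢0 = 0≢1 ∘ sym
    Π-≢0 {suc n} f f≢0 = *-≢0 (f≢0 zero) (Π-≢0 (f ∘ suc) (f≢0 ∘ suc))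

    -- With `0#` replaced by `1#`, a product over the whole field is the product of its nonzero
    -- elements.
    nonzero : Fin q → Fin q
    nonzero x with x ≟ 0#
    ... | yes _ = 1#
    ... | no _  = x

    nonzero-≢0 : ∀ x → nonzero x ≢ 0#
    nonzero-≢0 x with x ≟ 0#
    ... | yes _  = 0≢1 ∘ sym
    ... | no x≢0 = x≢0

    nonzero-* : ∀ {a x} → a ≢ 0# → x ≢ 0# → nonzero (a * x) ≡ a * nonzero x
    nonzero-* {a} {x} a≢0 x≢0 with a * x ≟ 0# | x ≟ 0#
    ... | yes ax≡0 | _       = contradiction ax≡0 (*-≢0 a≢0 x≢0)
    ... | no _     | yes x≡0 = contradiction x≡0 x≢0
    ... | no _     | no _    = refl

  -- Multiplication by a permutes the nonzero elements, so their product P satisfies P = a^(q-1) P.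
  x^[q-1]≡1 : ∀ {a} → a ≢ 0# → a ^ (q ∸ 1) ≡ 1#
  x^[q-1]≡1 {a} a≢0 = go refl
    where
    -- Matching on `r` exhibits the order of the field as a successor; order zero is impossible
    -- because `0#` exists.
    go : ∀ {r} → r ≡ q → a ^ (r ∸ 1) ≡ 1#
    go {zero} refl with () ← 0#
    go {suc r} refl = *-cancelˡ P≢0 (begin
      P * a ^ r                        ≡⟨ *-comm _ _ ⟩
      a ^ r * P                        ≡⟨ cong (_* P) (Π.sum-replicate r) ⟨
      Π.sum (replicate r a) * P        ≡⟨ Π.∑-distrib-+ (replicate r a) _ ⟨
      Π.sum (λ j → a * nonzero (punchIn 0# j)) ≡⟨ Π.sum-cong-≗ (λ j → nonzero-* a≢0 (punchInᵢ≢i 0# j)) ⟨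
      Π.sum (λ j → nonzero (a * punchIn 0# j)) ≡⟨ *-cancelˡ (nonzero-≢0 0#) removed ⟨
      P                                ≡⟨ *-identityʳ P ⟨
      P * 1#                           ∎)
      where
      P : Fin q
      P = Π.sum (λ j → nonzero (punchIn 0# j))
      P≢0 : P ≢ 0#
      P≢0 = Π-≢0 _ (λ j → nonzero-≢0 (punchIn 0# j))
      -- The product over the whole field is invariant under multiplication by `a`, and the factor
      -- at `0#` is the same on both sides.
      removed : nonzero 0# * P ≡ nonzero 0# * Π.sum (λ j → nonzero (a * punchIn 0# j))
      removed = begin
        nonzero 0# * P                ≡⟨ Π.sum-remove {i = 0#} nonzero ⟨
        Π.sum nonzero                 ≡⟨ Π.sum-permute nonzero (injective⇒permutation (a *_) (*-cancelˡ a≢0)) ⟩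
        Π.sum (λ x → nonzero (a * x)) ≡⟨ Π.sum-remove {i = 0#} (λ x → nonzero (a * x)) ⟩
        nonzero (a * 0#) * Π.sum (λ j → nonzero (a * punchIn 0# j)) ≡⟨ cong (λ z → nonzero z * Π.sum (λ j → nonzero (a * punchIn 0# j))) (zeroʳ a) ⟩
        nonzero 0# * Π.sum (λ j → nonzero (a * punchIn 0# j)) ∎

  x^q≡x : ∀ x → x ^ q ≡ x
  x^q≡x x = go refl
    where
    go : ∀ {r} → r ≡ q → x ^ r ≡ x
    go {zero} refl with () ← 0#
    go {suc r} refl with x ≟ 0#
    ... | yes refl = zeroˡ _
    ... | no x≢0   = trans (cong (x *_) (x^[q-1]≡1 x≢0)) (*-identityʳ x)

  -- Translation by 1 permutes the field, so the sum S of all elements satisfies S = S + q · 1.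
  q·1≡0 : q · 1# ≡ 0#
  q·1≡0 = +-cancelˡ (Σ.sum id) _ _ (begin
    Σ.sum id + q · 1#                ≡⟨ cong (_+_ (Σ.sum id)) (Σ.sum-replicate q) ⟨
    Σ.sum id + Σ.sum (replicate q 1#) ≡⟨ Σ.∑-distrib-+ id (replicate q 1#) ⟨
    Σ.sum (λ x → x + 1#)             ≡⟨ Σ.sum-permute id (injective⇒permutation (_+ 1#) (+-cancelʳ 1# _ _)) ⟨
    Σ.sum id                         ≡⟨ +-identityʳ _ ⟨
    Σ.sum id + 0#                    ∎)

  -- Polynomial functions and their roots

  -- f is a polynomial function of degree at most d, and c its coefficient at x^d.
  IsPolynomial : ℕ → (Fin q → Fin q) → Fin q → Set
  IsPolynomial zero    f c = ∀ x → f x ≡ c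
  IsPolynomial (suc d) f c = ∀ r → ∃ λ g → IsPolynomial d g c × (∀ x → f x ≡ f r + (x - r) * g x)

  polynomial-cong : ∀ d {f g c} → (∀ x → f x ≡ g x) → IsPolynomial d f c → IsPolynomial d g c
  polynomial-cong zero    f≗g f-poly x = trans (sym (f≗g x)) (f-poly x)
  polynomial-cong (suc d) f≗g f-poly r with h , h-poly , eq ← f-poly r =
    h , h-poly , λ x → trans (sym (f≗g x)) (trans (eq x) (cong (_+ (x - r) * h x) (f≗g r)))

  polynomial-+ : ∀ d {f g a b} → IsPolynomial d f a → IsPolynomial d g b → IsPolynomial d (λ x → f x + g x) (a + b)
  polynomial-+ zero    f-poly g-poly x = cong₂ _+_ (f-poly x) (g-poly x)
  polynomial-+ (suc d) {f} {g} f-poly g-poly r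
    with h , h-poly , f-eq ← f-poly r | k , k-poly , g-eq ← g-poly r
    = _ , polynomial-+ d h-poly k-poly , λ x → trans (cong₂ _+_ (f-eq x) (g-eq x))
      (solve 5 (λ u v w h k → (u :+ w :* h) :+ (v :+ w :* k) := (u :+ v) :+ w :* (h :+ k)) refl (f r) (g r) (x - r) (h x) (k x))

  polynomial-scale : ∀ d {f c} a → IsPolynomial d f c → IsPolynomial d (λ x → a * f x) (a * c)
  polynomial-scale zero    a f-poly x = cong (a *_) (f-poly x)
  polynomial-scale (suc d) {f} a f-poly r with h , h-poly , eq ← f-poly r =
    _ , polynomial-scale d a h-poly , λ x → trans (cong (a *_) (eq x))
      (solve 4 (λ a u w h → a :* (u :+ w :* h) := a :* u :+ w :* (a :* h)) refl a (f r) (x - r) (h x))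

  polynomial-raise : ∀ d {f c} → IsPolynomial d f c → IsPolynomial (suc d) f 0#
  polynomial-raise zero f-poly r = (λ _ → 0#) , (λ _ → refl) , λ x →
    trans (f-poly x) (trans (sym (f-poly r)) (solve 2 (λ u w → u := u :+ w :* con (+ 0)) refl _ (x - r)))
  polynomial-raise (suc d) f-poly r with h , h-poly , eq ← f-poly r = h , polynomial-raise d h-poly , eq

  polynomial-≤ : ∀ {d e f c} → d ℕ.< e → IsPolynomial d f c → IsPolynomial e f 0#
  polynomial-≤ {d} d<e = go (ℕ.<⇒<′ d<e)
    where
    go : ∀ {e f c} → d ℕ.<′ e → IsPolynomial d f c → IsPolynomial e f 0#
    go ℕ.<′-base        = polynomial-raise d
    go (ℕ.<′-step d<′e) = polynomial-raise _ ∘ go d<′e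

  -- If `g` is the quotient of `f` at `r`, then x f(x) has quotient x g(x) + f(r); the added
  -- constant is of lower degree and leaves the leading coefficient alone.
  polynomial-x* : ∀ d {f c} → IsPolynomial d f c → IsPolynomial (suc d) (λ x → x * f x) c
  polynomial-x* zero {f} {c} f-poly r = f , f-poly , λ x → begin
    x * f x                     ≡⟨ solve 3 (λ x r f → x :* f := r :* f :+ (x :- r) :* f) refl x r (f x) ⟩
    r * f x + (x - r) * f x     ≡⟨ cong (λ z → r * z + (x - r) * f x) (trans (f-poly x) (sym (f-poly r))) ⟩
    r * f r + (x - r) * f x     ∎
  polynomial-x* (suc d) {f} {c} f-poly r with g , g-poly , eq ← f-poly r =
    (λ x → x * g x + f r) ,
    subst (IsPolynomial (suc d) _) (+-identityʳ c) (polynomial-+ (suc d) (polynomial-x* d g-poly) (const-poly d (f r))) ,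
    λ x → begin
      x * f x                                 ≡⟨ cong (x *_) (eq x) ⟩
      x * (f r + (x - r) * g x)               ≡⟨ solve 4 (λ x r u g → x :* (u :+ (x :- r) :* g) := r :* u :+ (x :- r) :* (x :* g :+ u)) refl x r (f r) (g x) ⟩
      r * f r + (x - r) * (x * g x + f r)     ∎
    where
    const-poly : ∀ d a → IsPolynomial (suc d) (λ _ → a) 0#
    const-poly d a = polynomial-≤ {0} {suc d} {c = a} (ℕ.s≤s ℕ.z≤n) (λ _ → refl)

  polynomial-^ : ∀ d → IsPolynomial d (_^ d) 1#
  polynomial-^ zero    x = refl
  polynomial-^ (suc d)   = polynomial-x* d (polynomial-^ d)

  -- Dividing by x - `root zero` keeps the leading coefficient, and the quotient vanishes at the
  -- other roots because there are no zero divisors. In degree 0 one root remains, and the value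
  -- there is `c`.
  root-bound : ∀ d {f c} → IsPolynomial d f c → (root : Fin (suc d) → Fin q) → Injective _≡_ _≡_ root →
    (∀ i → f (root i) ≡ 0#) → c ≡ 0#
  root-bound zero    f-poly root inj vanish = trans (sym (f-poly _)) (vanish zero)
  root-bound (suc d) {f} f-poly root inj vanish with g , g-poly , eq ← f-poly (root zero) =
    root-bound d g-poly (root ∘ suc) (suc-injective ∘ inj) (λ i → x*y≡0⇒y≡0
      (λ rᵢ-r₀≡0 → contradiction (inj (x-y≡0⇒x≡y _ _ rᵢ-r₀≡0)) λ ())
      (+-cancelˡ 0# _ _ (begin
        0# + (root (suc i) - root zero) * g (root (suc i))          ≡⟨ cong (_+ _) (vanish zero) ⟨
        f (root zero) + (root (suc i) - root zero) * g (root (suc i)) ≡⟨ eq (root (suc i)) ⟨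
        f (root (suc i))                                            ≡⟨ vanish (suc i) ⟩
        0#                                                          ≡⟨ +-identityʳ 0# ⟨
        0# + 0#                                                     ∎)))

  -- Otherwise any d + 1 distinct elements, available as d < q, would be too many roots.
  polynomial-nonzero : ∀ {d f c} → d ℕ.< q → IsPolynomial d f c → c ≢ 0# → ∃ λ x → f x ≢ 0#
  polynomial-nonzero {d} {f} d<q f-poly c≢0 = ¬∀⟶∃¬ q _ (λ x → f x ≟ 0#) λ vanish →
    c≢0 (root-bound d f-poly (λ i → inject≤ i d<q) (inject≤-injective d<q d<q _ _) (λ i → vanish (inject≤ i d<q)))

-- Involutions, the fixed field and the relative trace

module FieldWithInvolution {q} (F : FiniteField q) where

  open FieldProperties F
  open ≡-Reasoning

  module Involution
    (σ : Fin q → Fin q)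
    (σ-+ : ∀ x y → σ (x + y) ≡ σ x + σ y)
    (σ-* : ∀ x y → σ (x * y) ≡ σ x * σ y)
    (σ-involutive : ∀ x → σ (σ x) ≡ x)
    (ξ : Fin q) (σξ≢ξ : σ ξ ≢ ξ)
    (2≢0 : 1# + 1# ≢ 0#)
    where

    Fixed : Fin q → Set
    Fixed x = σ x ≡ x

    fixed? : ∀ x → Dec (Fixed x)
    fixed? x = σ x ≟ x

    fixed-+ : ∀ {x y} → Fixed x → Fixed y → Fixed (x + y)
    fixed-+ {x} {y} fx fy = trans (σ-+ x y) (cong₂ _+_ fx fy)

    fixed-* : ∀ {x y} → Fixed x → Fixed y → Fixed (x * y)
    fixed-* {x} {y} fx fy = trans (σ-* x y) (cong₂ _*_ fx fy)

    fixed-0 : Fixed 0#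
    fixed-0 = +-cancelˡ (σ 0#) _ _ (begin
      σ 0# + σ 0#  ≡⟨ σ-+ 0# 0# ⟨
      σ (0# + 0#)  ≡⟨ cong σ (+-identityˡ 0#) ⟩
      σ 0#         ≡⟨ +-identityʳ _ ⟨
      σ 0# + 0#    ∎)

    fixed-1 : Fixed 1#
    fixed-1 = begin
      σ 1#              ≡⟨ *-identityˡ _ ⟨
      -- Writing `1#` as `σ (σ 1#)` makes it unnecessary to know beforehand that `σ 1#` is nonzero.
      1# * σ 1#         ≡⟨ cong (_* σ 1#) (σ-involutive 1#) ⟨
      σ (σ 1#) * σ 1#   ≡⟨ σ-* (σ 1#) 1# ⟨
      σ (σ 1# * 1#)     ≡⟨ cong σ (*-identityʳ _) ⟩
      σ (σ 1#)          ≡⟨ σ-involutive 1# ⟩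
      1#                ∎

    σ-neg : ∀ x → σ (- x) ≡ - σ x
    σ-neg x = +-cancelˡ (σ x) _ _ (begin
      σ x + σ (- x)    ≡⟨ σ-+ x (- x) ⟨
      σ (x - x)        ≡⟨ cong σ (-‿inverseʳ x) ⟩
      σ 0#             ≡⟨ fixed-0 ⟩
      0#               ≡⟨ -‿inverseʳ (σ x) ⟨
      σ x - σ x        ∎)

    fixed-neg : ∀ {x} → Fixed x → Fixed (- x)
    fixed-neg {x} fx = trans (σ-neg x) (cong -_ fx)

    fixed-sub : ∀ {x y} → Fixed x → Fixed y → Fixed (x - y)
    fixed-sub fx fy = fixed-+ fx (fixed-neg fy)

    fixed-⁻¹ : ∀ {x} → x ≢ 0# → Fixed x → Fixed (x ⁻¹)
    fixed-⁻¹ {x} x≢0 fx = *-cancelˡ x≢0 (begin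
      x * σ (x ⁻¹)      ≡⟨ cong (_* σ (x ⁻¹)) fx ⟨
      σ x * σ (x ⁻¹)    ≡⟨ σ-* x (x ⁻¹) ⟨
      σ (x * x ⁻¹)      ≡⟨ cong σ (⁻¹-inverseʳ x≢0) ⟩
      σ 1#              ≡⟨ fixed-1 ⟩
      1#                ≡⟨ ⁻¹-inverseʳ x≢0 ⟨
      x * x ⁻¹          ∎)

    T : Fin q → Fin q
    T x = x + σ x

    fixed-T : ∀ x → Fixed (T x)
    fixed-T x = trans (σ-+ x (σ x)) (trans (cong (_+_ (σ x)) (σ-involutive x)) (+-comm _ _))

    T-+ : ∀ x y → T (x + y) ≡ T x + T y
    T-+ x y = trans (cong (_+_ (x + y)) (σ-+ x y))
      (solve 4 (λ x y u v → (x :+ y) :+ (u :+ v) := (x :+ u) :+ (y :+ v)) refl x y (σ x) (σ y))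

    T-* : ∀ {y} → Fixed y → ∀ x → T (y * x) ≡ y * T x
    T-* {y} fy x = trans (cong (_+_ (y * x)) (trans (σ-* y x) (cong (_* σ x) fy))) (sym (distribˡ y x (σ x)))

    T-neg : ∀ x → T (- x) ≡ - T x
    T-neg x = trans (cong (_+_ (- x)) (σ-neg x)) (solve 2 (λ x u → :- x :+ :- u := :- (x :+ u)) refl x (σ x))

    T-sub : ∀ x y → T (x - y) ≡ T x - T y
    T-sub x y = trans (T-+ x (- y)) (cong (_+_ (T x)) (T-neg y))

    -- One half. Multiplication by it is a right inverse of `T` on the fixed field.
    ε : Fin q
    ε = (1# + 1#) ⁻¹

    Tε≡1 : T ε ≡ 1#
    Tε≡1 = begin
      ε + σ ε          ≡⟨ cong (_+_ ε) (fixed-⁻¹ 2≢0 (fixed-+ fixed-1 fixed-1)) ⟩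
      ε + ε            ≡⟨ solve 1 (λ x → x :+ x := (con (+ 1) :+ con (+ 1)) :* x) refl ε ⟩
      -- The solver evaluates `con (+ 1)` to `1# + 0#`.
      ((1# + 0#) + (1# + 0#)) * ε ≡⟨ cong (_* ε) (cong₂ _+_ (+-identityʳ 1#) (+-identityʳ 1#)) ⟩
      (1# + 1#) * ε    ≡⟨ ⁻¹-inverseʳ 2≢0 ⟩
      1#               ∎

    -- A nonzero element negated by `σ`. The kernel of `T` is δ K.
    δ : Fin q
    δ = σ ξ - ξ

    δ≢0 : δ ≢ 0#
    δ≢0 = σξ≢ξ ∘ x-y≡0⇒x≡y _ _

    σδ≡-δ : σ δ ≡ - δ
    σδ≡-δ = trans (σ-+ (σ ξ) (- ξ)) (trans (cong₂ _+_ (σ-involutive ξ) (σ-neg ξ))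
      (solve 2 (λ x y → x :- y := :- (y :- x)) refl ξ (σ ξ)))

    T-δ : ∀ x → T (δ * x) ≡ δ * (x - σ x)
    T-δ x = trans (cong (_+_ (δ * x)) (trans (σ-* δ x) (cong (_* σ x) σδ≡-δ)))
      (solve 3 (λ d x y → d :* x :+ (:- d) :* y := d :* (x :- y)) refl δ x (σ x))

    fixed⇒T-δ≡0 : ∀ {x} → Fixed x → T (δ * x) ≡ 0#
    fixed⇒T-δ≡0 {x} fx = trans (T-δ x) (trans (cong (δ *_) (x≡y⇒x-y≡0 (sym fx))) (zeroʳ δ))

    T-δ≡0⇒fixed : ∀ {x} → T (δ * x) ≡ 0# → Fixed x
    T-δ≡0⇒fixed {x} eq = sym (x-y≡0⇒x≡y _ _ (x*y≡0⇒y≡0 δ≢0 (trans (sym (T-δ x)) eq)))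

    ¬fixed-δ : ¬ Fixed δ
    ¬fixed-δ fδ = *-≢0 2≢0 δ≢0 (begin
      (1# + 1#) * δ    ≡⟨ trans (*-comm _ _) (trans (distribˡ δ 1# 1#) (cong₂ _+_ (*-identityʳ δ) (*-identityʳ δ))) ⟩
      δ + δ            ≡⟨ cong (_+_ δ) (trans (sym fδ) σδ≡-δ) ⟩
      δ - δ            ≡⟨ -‿inverseʳ δ ⟩
      0#               ∎)

    -- The field as a plane over the fixed field

    -- Over the fixed field, ω x is a linear form whose kernel is the line spanned by x.
    ω : Fin q → Fin q → Fin q
    ω x w = T (δ * (w * x ⁻¹))

    ω-+ : ∀ x u v → ω x (u + v) ≡ ω x u + ω x v
    ω-+ x u v = trans
      (cong T (solve 4 (λ d u v i → d :* ((u :+ v) :* i) := d :* (u :* i) :+ d :* (v :* i)) refl δ u v (x ⁻¹)))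
      (T-+ _ _)

    ω-* : ∀ x {y} → Fixed y → ∀ w → ω x (y * w) ≡ y * ω x w
    ω-* x {y} fy w = trans
      (cong T (solve 4 (λ d y w i → d :* ((y :* w) :* i) := y :* (d :* (w :* i))) refl δ y w (x ⁻¹)))
      (T-* fy _)

    ω-self : ∀ {x} → x ≢ 0# → ω x x ≡ 0#
    ω-self x≢0 = fixed⇒T-δ≡0 (trans (cong σ (⁻¹-inverseʳ x≢0)) (trans fixed-1 (sym (⁻¹-inverseʳ x≢0))))

    fixed-ω : ∀ x w → Fixed (ω x w)
    fixed-ω x w = fixed-T _

    ω-shift : ∀ {x} → x ≢ 0# → ∀ u {y} → Fixed y → ω x (u + y * x) ≡ ω x u
    ω-shift {x} x≢0 u {y} fy = begin
      ω x (u + y * x)       ≡⟨ ω-+ x u (y * x) ⟩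
      ω x u + ω x (y * x)   ≡⟨ cong (_+_ (ω x u)) (trans (ω-* x fy x) (trans (cong (y *_) (ω-self x≢0)) (zeroʳ y))) ⟩
      ω x u + 0#            ≡⟨ +-identityʳ _ ⟩
      ω x u                 ∎

    x*y⁻¹*y≡x : ∀ {x y} → y ≢ 0# → (x * y ⁻¹) * y ≡ x
    x*y⁻¹*y≡x {x} {y} y≢0 = begin
      (x * y ⁻¹) * y     ≡⟨ solve 3 (λ x i y → (x :* i) :* y := x :* (y :* i)) refl x (y ⁻¹) y ⟩
      x * (y * y ⁻¹)     ≡⟨ cong (x *_) (⁻¹-inverseʳ y≢0) ⟩
      x * 1#             ≡⟨ *-identityʳ x ⟩
      x                  ∎

    -- The condition `ω x u ≢ 0#` says that `u` and `x` are independent over K. The form `ω x` reads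
    -- off the coordinate at `u`; what remains lies in its kernel K x.
    module Coordinates {x u} (x≢0 : x ≢ 0#) (ωxu≢0 : ω x u ≢ 0#) where

      coord₁ coord₂ : Fin q → Fin q
      coord₁ w = ω x w * ω x u ⁻¹
      coord₂ w = (w - coord₁ w * u) * x ⁻¹

      fixed-coord₁ : ∀ w → Fixed (coord₁ w)
      fixed-coord₁ w = fixed-* (fixed-ω x w) (fixed-⁻¹ ωxu≢0 (fixed-ω x u))

      fixed-coord₂ : ∀ w → Fixed (coord₂ w)
      fixed-coord₂ w = T-δ≡0⇒fixed (begin
        ω x (w - c * u)               ≡⟨ cong (ω x) (solve 3 (λ w c u → w :- c :* u := w :+ (:- c) :* u) refl w c u) ⟩
        ω x (w + (- c) * u)           ≡⟨ ω-+ x w _ ⟩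
        ω x w + ω x ((- c) * u)       ≡⟨ cong (_+_ (ω x w)) (ω-* x (fixed-neg (fixed-coord₁ w)) u) ⟩
        ω x w + (- c) * ω x u         ≡⟨ solve 3 (λ a c b → a :+ (:- c) :* b := a :- c :* b) refl (ω x w) c (ω x u) ⟩
        ω x w - c * ω x u             ≡⟨ cong (λ z → ω x w - z) (x*y⁻¹*y≡x ωxu≢0) ⟩
        ω x w - ω x w                 ≡⟨ -‿inverseʳ _ ⟩
        0#                            ∎)
        where c = coord₁ w

      coordinates : ∀ w → w ≡ coord₁ w * u + coord₂ w * x
      coordinates w = begin
        w                                        ≡⟨ solve 2 (λ w a → w := a :+ (w :- a)) refl w (coord₁ w * u) ⟩
        coord₁ w * u + (w - coord₁ w * u)        ≡⟨ cong (_+_ (coord₁ w * u)) (x*y⁻¹*y≡x x≢0) ⟨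
        coord₁ w * u + coord₂ w * x              ∎

    -- A family of lines with one line in each direction

    module Kakeya
      (g : Fin q → Fin q)
      (g-injective : Injective _≡_ _≡_ g)
      (g-homogeneous : ∀ {y} → Fixed y → ∀ x → g (y * x) ≡ y * g x)
      where

      h : Fin q → Fin q → Fin q
      h a w = T (g w - a * w)

      h-homogeneous : ∀ a {y} → Fixed y → ∀ w → h a (y * w) ≡ y * h a w
      h-homogeneous a {y} fy w = trans
        (cong T (trans (cong (λ z → z - a * (y * w)) (g-homogeneous fy w))
          (solve 4 (λ y z a w → y :* z :- a :* (y :* w) := y :* (z :- a :* w)) refl y (g w) a w)))
        (T-* fy _)

      -- `δ * x ⁻¹` is the direction of the line of `x`: the correction vanishes at `w` = `x`, while
      -- for `w` outside K x a unique `z` in K leads to the line of `w`.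
      h-translate : ∀ a {z} → Fixed z → ∀ x w → h (a + z * (δ * x ⁻¹)) w ≡ h a w - z * ω x w
      h-translate a {z} fz x w = begin
        T (g w - (a + z * (δ * x ⁻¹)) * w)
          ≡⟨ cong T (solve 6 (λ G a z d i w → G :- (a :+ z :* (d :* i)) :* w := (G :- a :* w) :- z :* (d :* (w :* i))) refl (g w) a z δ (x ⁻¹) w) ⟩
        T ((g w - a * w) - z * (δ * (w * x ⁻¹)))
          ≡⟨ T-sub _ _ ⟩
        h a w - T (z * (δ * (w * x ⁻¹)))
          ≡⟨ cong (λ t → h a w - t) (T-* fz _) ⟩
        h a w - z * ω x w ∎

      -- Through b passes exactly one of the lines { a | h a w ≡ 0 }, namely that of w = x.
      record SimplePoint : Set where
        field
          {b x u} : Fin q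
          b≢0     : b ≢ 0#
          x≢0     : x ≢ 0#
          ωxu≢0   : ω x u ≢ 0#
          hx≡0    : h b x ≡ 0#
          h≢0     : ∀ {y} → Fixed y → h b (u + y * x) ≢ 0#

      private
        abstract
          -- Since `g x₀` = δ spans the kernel of `T`, the line of `x₀` passes through 0.
          x₀ : Fin q
          x₀ = proj₁ (injective⇒surjective g g-injective δ)

          gx₀≡δ : g x₀ ≡ δ
          gx₀≡δ = proj₂ (injective⇒surjective g g-injective δ)

        g0≡0 : g 0# ≡ 0#
        g0≡0 = trans (cong g (sym (zeroˡ 0#))) (trans (g-homogeneous fixed-0 0#) (zeroˡ _))

        x₀≢0 : x₀ ≢ 0#
        x₀≢0 x₀≡0 = δ≢0 (trans (sym gx₀≡δ) (trans (cong g x₀≡0) g0≡0))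

        h0 : ∀ w → h 0# w ≡ T (g w)
        h0 w = cong T (trans (cong (λ t → g w - t) (zeroˡ w)) (trans (cong (_+_ (g w)) -0#≈0#) (+-identityʳ _)))

        h0x₀≡0 : h 0# x₀ ≡ 0#
        h0x₀≡0 = trans (h0 x₀) (trans (cong T (trans gx₀≡δ (sym (*-identityʳ δ)))) (fixed⇒T-δ≡0 fixed-1))

        -- No other line passes through 0: if `T (g w)` vanishes then `g w` = y δ = `g (y * x₀)`
        -- with y in K, and injectivity gives `w` = y x₀.
        h0≡0⇒ωx₀≡0 : ∀ {w} → h 0# w ≡ 0# → ω x₀ w ≡ 0#
        h0≡0⇒ωx₀≡0 {w} eq = trans (cong (ω x₀) w≡yx₀) (trans (ω-* x₀ fy x₀) (trans (cong (y *_) (ω-self x₀≢0)) (zeroʳ y)))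
          where
          y = g w * δ ⁻¹
          gw≡yδ : g w ≡ y * δ
          gw≡yδ = sym (x*y⁻¹*y≡x δ≢0)
          fy : Fixed y
          fy = T-δ≡0⇒fixed (trans (cong T (trans (*-comm δ y) (sym gw≡yδ))) (trans (sym (h0 w)) eq))
          w≡yx₀ : w ≡ y * x₀
          w≡yx₀ = g-injective (trans gw≡yδ (trans (cong (y *_) (sym gx₀≡δ)) (sym (g-homogeneous fy x₀))))

        -- Independent of `x₀` because δ is not fixed. The elements `x₁ + y * x₀` with `y` in K
        -- represent all lines other than that of `x₀`, each once.
        x₁ : Fin q
        x₁ = δ * x₀

        ωx₀x₁≢0 : ω x₀ x₁ ≢ 0#
        ωx₀x₁≢0 eq = ¬fixed-δ (subst Fixed (trans (*-assoc δ x₀ _) (trans (cong (δ *_) (⁻¹-inverseʳ x₀≢0)) (*-identityʳ δ))) (T-δ≡0⇒fixed eq))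

        -- `ω` tests whether a ratio lies in K, and exchanging the arguments inverts the ratio.
        ω-sym : ∀ {x u} → x ≢ 0# → u ≢ 0# → ω u x ≢ 0# → ω x u ≢ 0#
        ω-sym {x} {u} x≢0 u≢0 ωux≢0 ωxu≡0 = ωux≢0 (fixed⇒T-δ≡0 (subst Fixed (sym ratio) (fixed-⁻¹ y≢0 fy)))
          where
          y = u * x ⁻¹
          fy : Fixed y
          fy = T-δ≡0⇒fixed ωxu≡0
          y≢0 : y ≢ 0#
          y≢0 = *-≢0 u≢0 (⁻¹-≢0 x≢0)
          ratio : x * u ⁻¹ ≡ y ⁻¹
          ratio = *-cancelˡ y≢0 (begin
            y * (x * u ⁻¹)      ≡⟨ *-assoc y x _ ⟨
            (y * x) * u ⁻¹      ≡⟨ cong (_* u ⁻¹) (x*y⁻¹*y≡x x≢0) ⟩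
            u * u ⁻¹            ≡⟨ ⁻¹-inverseʳ u≢0 ⟩
            1#                  ≡⟨ ⁻¹-inverseʳ y≢0 ⟨
            y * y ⁻¹            ∎)

      -- A point `a` common to three distinct lines, those of `x₀`, `x` and `x + d * x₀`.
      record MultiplePoint : Set where
        field
          {a x d} : Fin q
          ωx₀x≢0  : ω x₀ x ≢ 0#
          hx₀≡0   : h a x₀ ≡ 0#
          hx≡0    : h a x ≡ 0#
          d≢0     : d ≢ 0#
          fixed-d : Fixed d
          hx′≡0   : h a (x + d * x₀) ≡ 0#

      -- The lines of w = x₁ + y x₀ meet the line of x₀ away from its point 0: too few points for them all.
      multiplePoint : MultiplePoint
      multiplePoint = meet (Subset.missed⇒collision-on fixed? f (λ _ → fixed-f _) fixed-0 f≢0)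
        where
        f : Fin q → Fin q
        -- The value of z for which `z * (δ * x₀ ⁻¹)` lies on the line of `x₁ + y * x₀`. The divisor
        -- does not depend on `y`, by `ω-shift`.
        f y = h 0# (x₁ + y * x₀) * ω x₀ x₁ ⁻¹

        fixed-f : ∀ y → Fixed (f y)
        fixed-f y = fixed-* (fixed-T _) (fixed-⁻¹ ωx₀x₁≢0 (fixed-ω x₀ x₁))

        f≢0 : ∀ {y} → Fixed y → f y ≢ 0#
        -- The value `0#` would put 0 on a line other than that of `x₀`. So `f` misses a point of K
        -- and must have a collision there.
        f≢0 fy = *-≢0 (λ eq → ωx₀x₁≢0 (trans (sym (ω-shift x₀≢0 x₁ fy)) (h0≡0⇒ωx₀≡0 eq))) (⁻¹-≢0 ωx₀x₁≢0)

        vanish : ∀ {z t} → Fixed z → Fixed t → z ≡ f t → h (0# + z * (δ * x₀ ⁻¹)) (x₁ + t * x₀) ≡ 0#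
        vanish {z} {t} fz ft z≡ft = trans (h-translate 0# fz x₀ _) (x≡y⇒x-y≡0 (sym (begin
          z * ω x₀ (x₁ + t * x₀)                        ≡⟨ cong₂ _*_ z≡ft (ω-shift x₀≢0 x₁ ft) ⟩
          (h 0# (x₁ + t * x₀) * ω x₀ x₁ ⁻¹) * ω x₀ x₁   ≡⟨ x*y⁻¹*y≡x ωx₀x₁≢0 ⟩
          h 0# (x₁ + t * x₀)                            ∎)))

        meet : (∃₂ λ y y′ → Fixed y × Fixed y′ × y ≢ y′ × f y ≡ f y′) → MultiplePoint
        -- The point `a` has parameter `f y` on the line of `x₀`; `x` is `x₁ + y * x₀` and `d` is
        -- `y′ - y`.
        meet (y , y′ , fy , fy′ , y≢y′ , eq) = record
          { ωx₀x≢0  = λ ω≡0 → ωx₀x₁≢0 (trans (sym (ω-shift x₀≢0 x₁ fy)) ω≡0)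
          ; hx₀≡0   = trans (h-translate 0# (fixed-f y) x₀ x₀)
              (trans (cong₂ _-_ h0x₀≡0 (trans (cong (f y *_) (ω-self x₀≢0)) (zeroʳ _))) (-‿inverseʳ 0#))
          ; hx≡0    = vanish (fixed-f y) fy refl
          ; d≢0     = λ d≡0 → y≢y′ (sym (x-y≡0⇒x≡y _ _ d≡0))
          ; fixed-d = fixed-sub fy′ fy
          ; hx′≡0   = trans
              (cong (h _) (solve 4 (λ u y y′ v → (u :+ y :* v) :+ (y′ :- y) :* v := u :+ y′ :* v) refl x₁ y y′ x₀))
              (vanish (fixed-f y) fy′ eq)
          }

      -- On the line of x two of the other lines meet in a, so some point of it lies on none of them.
      simplePoint : SimplePoint
      simplePoint = avoid (Subset.collision⇒missed-on fixed? f (λ _ → fixed-f _)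
                             fixed-0 (fixed-⁻¹ d≢0 fixed-d) (⁻¹-≢0 d≢0 ∘ sym) (trans f0≡0 (sym fd⁻¹≡0)))
        where
        open MultiplePoint multiplePoint

        x≢0 : x ≢ 0#
        x≢0 x≡0 = ωx₀x≢0 (trans (cong (λ w → T (δ * w)) (trans (cong (_* x₀ ⁻¹) x≡0) (zeroˡ _))) (fixed⇒T-δ≡0 fixed-0))

        ωxx₀≢0 : ω x x₀ ≢ 0#
        ωxx₀≢0 = ω-sym x≢0 x₀≢0 ωx₀x≢0

        f : Fin q → Fin q
        -- The parameter, counted from `a` along the line of `x`, of its intersection with the line
        -- of `x₀ + y * x`.
        f y = h a (x₀ + y * x) * ω x x₀ ⁻¹

        fixed-f : ∀ y → Fixed (f y)
        fixed-f y = fixed-* (fixed-T _) (fixed-⁻¹ ωxx₀≢0 (fixed-ω x x₀))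

        f0≡0 : f 0# ≡ 0#
        f0≡0 = trans (cong (λ w → h a w * ω x x₀ ⁻¹) (trans (cong (_+_ x₀) (zeroˡ x)) (+-identityʳ x₀)))
          (trans (cong (_* ω x x₀ ⁻¹) hx₀≡0) (zeroˡ _))

        -- `x₀ + d ⁻¹ * x` is a K-multiple of `x + d * x₀`, whose line passes through `a`; so does
        -- the line of `x₀`, which belongs to `y` = `0#`.
        fd⁻¹≡0 : f (d ⁻¹) ≡ 0#
        fd⁻¹≡0 = trans (cong (_* ω x x₀ ⁻¹) (begin
          h a (x₀ + d ⁻¹ * x)               ≡⟨ cong (λ t → h a (t + d ⁻¹ * x)) (trans (cong (_* x₀) (trans (*-comm _ _) (⁻¹-inverseʳ d≢0))) (*-identityˡ x₀)) ⟨
          h a ((d ⁻¹ * d) * x₀ + d ⁻¹ * x)  ≡⟨ cong (h a) (solve 4 (λ i d u x → (i :* d) :* u :+ i :* x := i :* (x :+ d :* u)) refl (d ⁻¹) d x₀ x) ⟩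
          h a (d ⁻¹ * (x + d * x₀))         ≡⟨ h-homogeneous a (fixed-⁻¹ d≢0 fixed-d) _ ⟩
          d ⁻¹ * h a (x + d * x₀)           ≡⟨ cong (d ⁻¹ *_) hx′≡0 ⟩
          d ⁻¹ * 0#                         ≡⟨ zeroʳ _ ⟩
          0#                                ∎)) (zeroˡ _)

        avoid : (∃ λ z → Fixed z × (∀ {y} → Fixed y → f y ≢ z)) → SimplePoint
        avoid (z , fz , z-missed) = record
          { b     = b
          -- At 0 the line of `x` would pass through 0, as only the line of `x₀` does.
          ; b≢0   = λ b≡0 → ωx₀x≢0 (h0≡0⇒ωx₀≡0 (subst (λ t → h t x ≡ 0#) b≡0 hbx≡0))
          ; x≢0   = x≢0
          ; ωxu≢0 = ωxx₀≢0
          ; hx≡0  = hbx≡0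
          ; h≢0   = λ {y} fy eq → z-missed fy (begin
              h a (x₀ + y * x) * ω x x₀ ⁻¹   ≡⟨ cong (_* ω x x₀ ⁻¹) (x-y≡0⇒x≡y _ _ (trans (sym (h-translate a fz x _)) eq)) ⟩
              (z * ω x (x₀ + y * x)) * ω x x₀ ⁻¹ ≡⟨ cong (λ t → (z * t) * ω x x₀ ⁻¹) (ω-shift x≢0 x₀ fy) ⟩
              (z * ω x x₀) * ω x x₀ ⁻¹       ≡⟨ *-assoc _ _ _ ⟩
              z * (ω x x₀ * ω x x₀ ⁻¹)       ≡⟨ cong (z *_) (⁻¹-inverseʳ ωxx₀≢0) ⟩
              z * 1#                         ≡⟨ *-identityʳ z ⟩
              z                              ∎)
          }
          where
          b = a + z * (δ * x ⁻¹)
          hbx≡0 : h b x ≡ 0#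
          hbx≡0 = trans (h-translate a fz x x) (trans (cong₂ _-_ hx≡0 (trans (cong (z *_) (ω-self x≢0)) (zeroʳ z))) (-‿inverseʳ 0#))

      -- Equidistribution at a simple point

      -- h b is equidistributed on the fixed field, because it factors as T ∘ Ψ with Ψ bijective.
      module Reparametrization (point : SimplePoint) where
        open SimplePoint point
        open Coordinates x≢0 ωxu≢0

        -- A coordinate along the fibres of `h b`: on the zero fibre K x the multiple of `x`,
        -- elsewhere the s in w = l (u + s x).
        slope : Fin q → Fin q
        slope w with coord₁ w ≟ 0#
        ... | yes _ = coord₂ w
        ... | no _  = coord₁ w ⁻¹ * coord₂ w

        fixed-slope : ∀ w → Fixed (slope w)
        fixed-slope w with coord₁ w ≟ 0#
        ... | yes _ = fixed-coord₂ w
        ... | no ≢0 = fixed-* (fixed-⁻¹ ≢0 (fixed-coord₁ w)) (fixed-coord₂ w)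

        -- The first term has relative trace `h b w` and the second lies in the kernel of `T`, so
        -- `Ψ w` encodes the pair of `h b w` and `slope w`.
        Ψ : Fin q → Fin q
        Ψ w = h b w * ε + δ * slope w

        TΨ≡h : ∀ w → T (Ψ w) ≡ h b w
        TΨ≡h w = begin
          T (h b w * ε + δ * slope w)     ≡⟨ T-+ _ _ ⟩
          T (h b w * ε) + T (δ * slope w) ≡⟨ cong₂ _+_ (T-* (fixed-T _) ε) (fixed⇒T-δ≡0 (fixed-slope w)) ⟩
          h b w * T ε + 0#                ≡⟨ +-identityʳ _ ⟩
          h b w * T ε                     ≡⟨ cong (h b w *_) Tε≡1 ⟩
          h b w * 1#                      ≡⟨ *-identityʳ _ ⟩
          h b w                           ∎

        on-line : ∀ {w} → coord₁ w ≡ 0# → w ≡ coord₂ w * x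
        on-line {w} eq = trans (coordinates w) (trans (cong (λ c → c * u + coord₂ w * x) eq)
          (trans (cong (_+ coord₂ w * x) (zeroˡ u)) (+-identityˡ _)))

        off-line : ∀ {w} → coord₁ w ≢ 0# → w ≡ coord₁ w * (u + (coord₁ w ⁻¹ * coord₂ w) * x)
        off-line {w} l≢0 = begin
          w                                      ≡⟨ coordinates w ⟩
          l * u + m * x                          ≡⟨ cong (λ t → l * u + t * x) (trans (cong (_* m) (⁻¹-inverseʳ l≢0)) (*-identityˡ m)) ⟨
          l * u + ((l * l ⁻¹) * m) * x           ≡⟨ solve 5 (λ l u i m x → l :* u :+ ((l :* i) :* m) :* x := l :* (u :+ (i :* m) :* x)) refl l u (l ⁻¹) m x ⟩
          l * (u + (l ⁻¹ * m) * x)               ∎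
          where l = coord₁ w ; m = coord₂ w

        h-on-line : ∀ {w} → coord₁ w ≡ 0# → h b w ≡ 0#
        h-on-line {w} eq = trans (cong (h b) (on-line eq))
          (trans (h-homogeneous b (fixed-coord₂ w) x) (trans (cong (coord₂ w *_) hx≡0) (zeroʳ _)))

        h-off-line : ∀ {w} → coord₁ w ≢ 0# → h b w ≡ coord₁ w * h b (u + (coord₁ w ⁻¹ * coord₂ w) * x)
        h-off-line {w} ≢0 = trans (cong (h b) (off-line ≢0)) (h-homogeneous b (fixed-coord₁ w) _)

        h-off-line≢0 : ∀ {w} → coord₁ w ≢ 0# → h b w ≢ 0#
        h-off-line≢0 {w} ≢0 eq = *-≢0 ≢0 (h≢0 (fixed-* (fixed-⁻¹ ≢0 (fixed-coord₁ w)) (fixed-coord₂ w))) (trans (sym (h-off-line ≢0)) eq)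

        -- Off K x the slope gives the direction u + s x, and the nonzero value of `h b` there
        -- determines the scalar l by homogeneity.
        recover : ∀ {w w′} → h b w ≡ h b w′ → slope w ≡ slope w′ → w ≡ w′
        recover {w} {w′} h≡h′ s≡s′ with coord₁ w ≟ 0# | coord₁ w′ ≟ 0#
        ... | yes l≡0 | yes l′≡0 = trans (on-line l≡0) (trans (cong (_* x) s≡s′) (sym (on-line l′≡0)))
        ... | yes l≡0 | no l′≢0  = contradiction (trans (sym h≡h′) (h-on-line l≡0)) (h-off-line≢0 l′≢0)
        ... | no l≢0  | yes l′≡0 = contradiction (trans h≡h′ (h-on-line l′≡0)) (h-off-line≢0 l≢0)
        ... | no l≢0  | no l′≢0  = trans (off-line l≢0) (trans (cong₂ (λ l s → l * (u + s * x)) l≡l′ s≡s′) (sym (off-line l′≢0)))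
          where
          s = coord₁ w ⁻¹ * coord₂ w
          l≡l′ : coord₁ w ≡ coord₁ w′
          l≡l′ = *-cancelˡ (h≢0 (fixed-* (fixed-⁻¹ l≢0 (fixed-coord₁ w)) (fixed-coord₂ w))) (begin
            h b (u + s * x) * coord₁ w   ≡⟨ *-comm _ _ ⟩
            coord₁ w * h b (u + s * x)   ≡⟨ h-off-line l≢0 ⟨
            h b w                        ≡⟨ h≡h′ ⟩
            h b w′                       ≡⟨ h-off-line l′≢0 ⟩
            coord₁ w′ * h b (u + (coord₁ w′ ⁻¹ * coord₂ w′) * x) ≡⟨ cong (λ s → coord₁ w′ * h b (u + s * x)) s≡s′ ⟨
            coord₁ w′ * h b (u + s * x)  ≡⟨ *-comm _ _ ⟩
            h b (u + s * x) * coord₁ w′  ∎)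

        Ψ-injective : Injective _≡_ _≡_ Ψ
        Ψ-injective {w} {w′} eq = recover h≡h′ (*-cancelˡ δ≢0 (+-cancelˡ (h b w * ε) _ _ (begin
          h b w * ε + δ * slope w     ≡⟨ eq ⟩
          h b w′ * ε + δ * slope w′   ≡⟨ cong (λ t → t * ε + δ * slope w′) h≡h′ ⟨
          h b w * ε + δ * slope w′    ∎)))
          where
          h≡h′ : h b w ≡ h b w′
          h≡h′ = trans (sym (TΨ≡h w)) (trans (cong T eq) (TΨ≡h w′))

      T-reparametrization : ∃ λ b → b ≢ 0# × ∃ λ Ψ → Injective _≡_ _≡_ Ψ × (∀ w → T (g w - b * w) ≡ T (Ψ w))
      T-reparametrization = SimplePoint.b simplePoint , SimplePoint.b≢0 simplePoint , Ψ , Ψ-injective , λ w → sym (TΨ≡h w)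
        where open Reparametrization simplePoint

-- Binomial coefficients at a prime

open import Data.Nat using (_≤_; _^_; _*_; _%_; _!)
open import Data.Nat.Combinatorics using (_C_; nCk≡n!/k![n-k]!; k![n∸k]!∣n!; nCn≡1)
open import Data.Nat.Divisibility using (_∣_; divides; m∣m*n; ∣⇒≤)
open import Data.Nat.DivMod using (m≡m%n+[m/n]*n; m/n*n≡m)
open import Data.Nat.GCD using (gcd; gcd-GCD; module Bézout)
open import Data.Nat.Primality using (Prime; euclidsLemma; prime⇒nonTrivial; prime⇒nonZero)

p∤k! : ∀ {p} → Prime p → ∀ {k} → k ℕ.< p → ¬ p ∣ k !
p∤k! {p} p-prime {zero}  _   p∣1 = contradiction (∣⇒≤ p∣1) (ℕ.<⇒≱ (ℕ.nonTrivial⇒n>1 p {{prime⇒nonTrivial p-prime}}))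
p∤k! {p} p-prime {suc k} k<p p∣k! with euclidsLemma (suc k) (k !) p-prime p∣k!
... | inj₁ p∣1+k = contradiction (∣⇒≤ p∣1+k) (ℕ.<⇒≱ k<p)
... | inj₂ p∣k!′ = p∤k! p-prime (ℕ.<-trans (ℕ.n<1+n k) k<p) p∣k!′

-- The prime divides p! = (p C k) k! (p - k)! but neither of the two factorials.
p∣pCk : ∀ {p} → Prime p → ∀ {k} → 0 ℕ.< k → k ℕ.< p → p ∣ p C k
p∣pCk {p} p-prime {k} 0<k k<p with euclidsLemma (p C k) (k ! * (p ∸ k) !) p-prime (subst (p ∣_) (sym p!≡) p∣p!)
  where
  instance _ = k ℕ.!* (p ∸ k) !≢0
  p!≡ : (p C k) * (k ! * (p ∸ k) !) ≡ p !
  p!≡ = trans (cong (_* (k ! * (p ∸ k) !)) (nCk≡n!/k![n-k]! (ℕ.<⇒≤ k<p))) (m/n*n≡m (k![n∸k]!∣n! (ℕ.<⇒≤ k<p)))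
  n∣n! : ∀ {n} → 0 ℕ.< n → n ∣ n !
  n∣n! {suc n} _ = m∣m*n (n !)
  p∣p! : p ∣ p !
  p∣p! = n∣n! (ℕ.<-trans 0<k k<p)
... | inj₁ p∣pCk = p∣pCk
... | inj₂ p∣k![p-k]! with euclidsLemma (k !) ((p ∸ k) !) p-prime p∣k![p-k]!
...   | inj₁ p∣k!     = contradiction p∣k! (p∤k! p-prime k<p)
...   | inj₂ p∣[p-k]! = contradiction p∣[p-k]! (p∤k! p-prime (ℕ.∸-monoʳ-< 0<k (ℕ.<⇒≤ k<p)))

-- Characteristic and Frobenius

module PrimePowerField {p m} (p-prime : Prime p) (F : FiniteField (p ^ m)) where

  open FieldProperties F hiding (_*_; _^_)
  open FieldProperties F using () renaming (_*_ to infixl 7 _⋆_; _^_ to infixr 8 _↑_)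
  private module F = FiniteField F
  open ≡-Reasoning

  -- Its m-th power is `(p ^ m) · 1#`, which vanishes, and a field has no nonzero nilpotents.
  p·1≡0 : p · 1# ≡ 0#
  p·1≡0 with p · 1# ≟ 0#
  ... | yes eq = eq
  ... | no  ≢0 = contradiction (trans (sym (power m)) q·1≡0) (^-≢0 m ≢0)
    where
    power : ∀ k → (p ^ k) · 1# ≡ (p · 1#) ↑ k
    power zero    = +-identityʳ 1#
    power (suc k) = trans (×1-homo-* p (p ^ k)) (cong (p · 1# ⋆_) (power k))

  p∣k⇒k·x≡0 : ∀ {k} → p ∣ k → ∀ x → k · x ≡ 0#
  p∣k⇒k·x≡0 (divides d refl) x = begin
    (d * p) · x             ≡⟨ cong ((d * p) ·_) (*-identityˡ x) ⟨
    (d * p) · (1# ⋆ x)      ≡⟨ ×-assoc-* (d * p) 1# x ⟨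
    ((d * p) · 1#) ⋆ x      ≡⟨ cong (_⋆ x) (×1-homo-* d p) ⟩
    (d · 1# ⋆ p · 1#) ⋆ x   ≡⟨ cong (λ z → (d · 1# ⋆ z) ⋆ x) p·1≡0 ⟩
    (d · 1# ⋆ 0#) ⋆ x       ≡⟨ trans (cong (_⋆ x) (zeroʳ _)) (zeroˡ x) ⟩
    0#                      ∎

  open import Algebra.Properties.CommutativeSemiring.Binomial commutativeSemiring using (binomialTerm) renaming (theorem to binomial-theorem)
  open import Algebra.Properties.Monoid.Sum +-monoid
    using (sum; sum-init-last; sum-cong-≗; sum-replicate-zero)

  -- The inner binomial coefficients are divisible by `p`, so only the outer terms of the expansion
  -- survive.
  frobenius-+ : ∀ x y → (x + y) ↑ p ≡ x ↑ p + y ↑ p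
  frobenius-+ x y = go (ℕ.suc-pred p {{prime⇒nonZero p-prime}})
    where
    go : ∀ {r} → suc r ≡ p → (x + y) ↑ p ≡ x ↑ p + y ↑ p
    go {r} refl = begin
      (x + y) ↑ suc r                  ≡⟨ binomial-theorem (suc r) x y ⟩
      sum t                            ≡⟨⟩
      t zero + sum (t ∘ suc)           ≡⟨ cong (_+_ (t zero)) (sum-init-last (t ∘ suc)) ⟩
      t zero + (sum (t ∘ suc ∘ inject₁) + t (fromℕ (suc r)))
        ≡⟨ cong (λ z → t zero + (z + t (fromℕ (suc r)))) (trans (sum-cong-≗ middle) (sum-replicate-zero r)) ⟩
      t zero + (0# + t (fromℕ (suc r))) ≡⟨ cong₂ (λ a b → a + (0# + b)) first last ⟩
      y ↑ suc r + (0# + x ↑ suc r)     ≡⟨ trans (cong (_+_ (y ↑ suc r)) (+-identityˡ _)) (+-comm _ _) ⟩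
      x ↑ suc r + y ↑ suc r            ∎
      where
      t : Fin (suc (suc r)) → Fin (p ^ m)
      t = binomialTerm x y (suc r)
      middle : ∀ i → t (suc (inject₁ i)) ≡ 0#
      middle i = p∣k⇒k·x≡0 (p∣pCk p-prime (s≤s z≤n) (s≤s (subst (ℕ._< r) (sym (toℕ-inject₁ i)) (toℕ<n i)))) _
      first : t zero ≡ y ↑ suc r
      first = trans (+-identityʳ _) (*-identityˡ _)
      last : t (fromℕ (suc r)) ≡ x ↑ suc r
      last rewrite toℕ-fromℕ r | nCn≡1 (suc r) | ℕ.n∸n≡0 r = trans (+-identityʳ _) (*-identityʳ _)

  x↑p^0 : ∀ x → x ↑ (p ^ 0) ≡ x
  x↑p^0 = *-identityʳ

  x↑p^[1+i] : ∀ x i → x ↑ (p ^ suc i) ≡ (x ↑ (p ^ i)) ↑ p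
  x↑p^[1+i] x i = trans (sym (^-assocʳ x p (p ^ i))) (^-comm x p (p ^ i))

  frobeniusⁱ-+ : ∀ i x y → (x + y) ↑ (p ^ i) ≡ x ↑ (p ^ i) + y ↑ (p ^ i)
  frobeniusⁱ-+ zero    x y = trans (x↑p^0 _) (sym (cong₂ _+_ (x↑p^0 x) (x↑p^0 y)))
  frobeniusⁱ-+ (suc i) x y = begin
    (x + y) ↑ (p ^ suc i)                 ≡⟨ x↑p^[1+i] (x + y) i ⟩
    ((x + y) ↑ (p ^ i)) ↑ p               ≡⟨ cong (_↑ p) (frobeniusⁱ-+ i x y) ⟩
    (x ↑ (p ^ i) + y ↑ (p ^ i)) ↑ p       ≡⟨ frobenius-+ _ _ ⟩
    (x ↑ (p ^ i)) ↑ p + (y ↑ (p ^ i)) ↑ p ≡⟨ cong₂ _+_ (x↑p^[1+i] x i) (x↑p^[1+i] y i) ⟨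
    x ↑ (p ^ suc i) + y ↑ (p ^ suc i)     ∎

  -- An additive map with trivial kernel.
  frobeniusⁱ-injective : ∀ i → Injective _≡_ _≡_ (_↑ (p ^ i))
  frobeniusⁱ-injective i {x} {y} eq with x - y ≟ 0#
  ... | yes x-y≡0 = x-y≡0⇒x≡y x y x-y≡0
  ... | no x-y≢0  = contradiction (+-cancelʳ (y ↑ (p ^ i)) _ _ (begin
    (x - y) ↑ (p ^ i) + y ↑ (p ^ i)   ≡⟨ frobeniusⁱ-+ i (x - y) y ⟨
    ((x - y) + y) ↑ (p ^ i)           ≡⟨ cong (_↑ (p ^ i)) (solve 2 (λ x y → (x :- y) :+ y := x) refl x y) ⟩
    x ↑ (p ^ i)                       ≡⟨ eq ⟩
    y ↑ (p ^ i)                       ≡⟨ +-identityˡ _ ⟨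
    0# + y ↑ (p ^ i)                  ∎)) (^-≢0 (p ^ i) x-y≢0)

  -- The absolute trace

  sumUpTo : ℕ → (ℕ → Fin (p ^ m)) → Fin (p ^ m)
  sumUpTo n f = F.sumF (applyUpTo f n)

  sumUpTo-cong : ∀ n {f g} → (∀ i → f i ≡ g i) → sumUpTo n f ≡ sumUpTo n g
  sumUpTo-cong zero    f≗g = refl
  sumUpTo-cong (suc n) f≗g = cong₂ _+_ (f≗g 0) (sumUpTo-cong n (f≗g ∘ suc))

  sumUpTo-+ : ∀ n f g → sumUpTo n (λ i → f i + g i) ≡ sumUpTo n f + sumUpTo n g
  sumUpTo-+ zero    f g = sym (+-identityˡ 0#)
  sumUpTo-+ (suc n) f g = trans (cong (_+_ (f 0 + g 0)) (sumUpTo-+ n (f ∘ suc) (g ∘ suc)))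
    (solve 4 (λ a b c d → (a :+ b) :+ (c :+ d) := (a :+ c) :+ (b :+ d)) refl (f 0) (g 0) _ _)

  sumUpTo-scale : ∀ n c f → sumUpTo n (λ i → c ⋆ f i) ≡ c ⋆ sumUpTo n f
  sumUpTo-scale zero    c f = sym (zeroʳ c)
  sumUpTo-scale (suc n) c f = trans (cong (_+_ (c ⋆ f 0)) (sumUpTo-scale n c (f ∘ suc))) (sym (distribˡ c _ _))

  sumUpTo-append : ∀ k n f → sumUpTo (k ℕ.+ n) f ≡ sumUpTo k f + sumUpTo n (λ i → f (k ℕ.+ i))
  sumUpTo-append zero    n f = sym (+-identityˡ _)
  sumUpTo-append (suc k) n f = trans (cong (_+_ (f 0)) (sumUpTo-append k n (f ∘ suc))) (sym (+-assoc _ _ _))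

  sumUpTo-last : ∀ n f → sumUpTo (suc n) f ≡ sumUpTo n f + f n
  sumUpTo-last zero    f = +-comm _ _
  sumUpTo-last (suc n) f = trans (cong (_+_ (f 0)) (sumUpTo-last n (f ∘ suc))) (sym (+-assoc _ _ _))

  sumUpTo-frobenius : ∀ n f → sumUpTo n f ↑ p ≡ sumUpTo n (λ i → f i ↑ p)
  sumUpTo-frobenius zero    f = 0^n≡0 (ℕ.≢-nonZero⁻¹ p {{prime⇒nonZero p-prime}})
  sumUpTo-frobenius (suc n) f = trans (frobenius-+ _ _) (cong (_+_ (f 0 ↑ p)) (sumUpTo-frobenius n (f ∘ suc)))

  trace : Fin (p ^ m) → Fin (p ^ m)
  trace x = sumUpTo m (λ i → x ↑ (p ^ i))

  Tr≡trace : ∀ x → Tr F p m x ≡ trace x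
  Tr≡trace x = trans (cong F.sumF (map-upTo (λ i → x F.^ (p ^ i)) m)) (sumUpTo-cong m (λ i → ^-agrees x (p ^ i)))

  trace-+ : ∀ x y → trace (x + y) ≡ trace x + trace y
  trace-+ x y = trans (sumUpTo-cong m (λ i → frobeniusⁱ-+ i x y)) (sumUpTo-+ m _ _)

  trace-0 : trace 0# ≡ 0#
  trace-0 = +-cancelˡ (trace 0#) _ _ (trans (sym (trace-+ 0# 0#)) (trans (cong trace (+-identityˡ 0#)) (sym (+-identityʳ _))))

  trace-· : ∀ k x → trace (k · x) ≡ k · trace x
  trace-· zero    x = trace-0
  trace-· (suc k) x = trans (trace-+ x (k · x)) (cong (_+_ (trace x)) (trace-· k x))

  -- Frobenius permutes the terms of the trace cyclically, because x ↑ (p ^ m) ≡ x.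
  sumUpTo-shift : ∀ x → sumUpTo m (λ i → x ↑ (p ^ suc i)) ≡ trace x
  sumUpTo-shift x = +-cancelˡ (x ↑ (p ^ 0)) _ _ (begin
    sumUpTo (suc m) (λ i → x ↑ (p ^ i))    ≡⟨ sumUpTo-last m _ ⟩
    trace x + x ↑ (p ^ m)                  ≡⟨ cong (_+_ (trace x)) (trans (x^q≡x x) (sym (x↑p^0 x))) ⟩
    trace x + x ↑ (p ^ 0)                  ≡⟨ +-comm _ _ ⟩
    x ↑ (p ^ 0) + trace x                  ∎)

  trace-frobenius : ∀ x → trace (x ↑ p) ≡ trace x
  trace-frobenius x = trans (sumUpTo-cong m (λ i → ^-assocʳ x p (p ^ i))) (sumUpTo-shift x)

  trace-frobeniusⁱ : ∀ i x → trace (x ↑ (p ^ i)) ≡ trace x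
  trace-frobeniusⁱ zero    x = cong trace (x↑p^0 x)
  trace-frobeniusⁱ (suc i) x = trans (cong trace (x↑p^[1+i] x i)) (trans (trace-frobenius _) (trace-frobeniusⁱ i x))

  -- The equation `y ↑ p ≡ y` expresses membership of the prime field, over which `trace-scale`
  -- makes the trace linear.
  trace↑p≡trace : ∀ x → trace x ↑ p ≡ trace x
  trace↑p≡trace x = trans (sumUpTo-frobenius m _) (trans (sumUpTo-cong m (λ i → sym (x↑p^[1+i] x i))) (sumUpTo-shift x))

  trace-scale : ∀ {c} → c ↑ p ≡ c → ∀ x → trace (c ⋆ x) ≡ c ⋆ trace x
  trace-scale {c} c↑p≡c x = trans (sumUpTo-cong m (λ i → trans (^-distrib-* c x (p ^ i)) (cong (_⋆ x ↑ (p ^ i)) (fixed i)))) (sumUpTo-scale m c _)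
    where
    fixed : ∀ i → c ↑ (p ^ i) ≡ c
    fixed zero    = x↑p^0 c
    fixed (suc i) = trans (x↑p^[1+i] c i) (trans (cong (_↑ p) (fixed i)) c↑p≡c)

  1<p : 1 ℕ.< p
  1<p = ℕ.nonTrivial⇒n>1 p {{prime⇒nonTrivial p-prime}}

  -- The trace is a monic polynomial of degree p^(m-1), smaller than the order p^m of the field.
  trace-nonzero : 1 ≤ m → ∃ λ x → trace x ≢ 0#
  trace-nonzero 1≤m = go refl 1≤m
    where
    -- The terms below the last have degree less than `p ^ e` and contribute 0 to the leading
    -- coefficient.
    lower : ∀ {e} k → k ≤ e → IsPolynomial (p ^ e) (λ x → sumUpTo k (λ i → x ↑ (p ^ i))) 0#
    lower {e} zero    _   = polynomial-≤ {0} {c = 0#} (ℕ.m^n>0 p {{prime⇒nonZero p-prime}} e) (λ _ → refl)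
    lower {e} (suc k) k<e = polynomial-cong (p ^ e) (λ x → sym (sumUpTo-last k _))
      (subst (IsPolynomial (p ^ e) _) (+-identityʳ 0#) (polynomial-+ (p ^ e) (lower k (ℕ.<⇒≤ k<e))
        (polynomial-≤ (ℕ.^-monoʳ-< p 1<p k<e) (polynomial-^ (p ^ k)))))

    go : ∀ {k} → k ≡ m → 1 ≤ k → ∃ λ x → sumUpTo k (λ i → x ↑ (p ^ i)) ≢ 0#
    go {suc e} refl _ = polynomial-nonzero (ℕ.^-monoʳ-< p 1<p (ℕ.n<1+n e))
      (polynomial-cong (p ^ e) (λ x → sym (sumUpTo-last e _))
        (polynomial-+ (p ^ e) (lower e ℕ.≤-refl) (polynomial-^ (p ^ e))))
      (λ 0+1≡0 → 0≢1 (trans (sym 0+1≡0) (+-identityˡ 1#)))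

  -- The inverse c of a nonzero trace value lies in the prime field, so `c ⋆ x` has trace 1; its
  -- multiples give the other values.
  trace-surjective : 1 ≤ m → ∀ k → ∃ λ x → trace x ≡ k · 1#
  trace-surjective 1≤m k = k · (c ⋆ x) , trans (trace-· k _) (cong (k ·_) (trans (trace-scale c↑p≡c x) (trans (*-comm _ _) (⁻¹-inverseʳ t≢0))))
    where
    x = proj₁ (trace-nonzero 1≤m)
    t = trace x
    t≢0 = proj₂ (trace-nonzero 1≤m)
    c = t ⁻¹
    c↑p≡c : c ↑ p ≡ c
    c↑p≡c = *-cancelˡ t≢0 (begin
      t ⋆ c ↑ p        ≡⟨ cong (_⋆ c ↑ p) (trace↑p≡trace x) ⟨
      t ↑ p ⋆ c ↑ p    ≡⟨ ^-distrib-* t c p ⟨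
      (t ⋆ c) ↑ p      ≡⟨ cong (_↑ p) (⁻¹-inverseʳ t≢0) ⟩
      1# ↑ p           ≡⟨ 1^n≡1 p ⟩
      1#               ≡⟨ ⁻¹-inverseʳ t≢0 ⟨
      t ⋆ c            ∎)

  -- Translation by an element of trace `k · 1#` carries the kernel of the trace to the fibre over
  -- `k · 1#`.
  trace-equidistributed : 1 ≤ m → ∀ k →
    length (filter (λ x → trace x ≟ k · 1#) (allFin _)) ≡ length (filter (λ x → trace x ≟ 0#) (allFin _))
  trace-equidistributed 1≤m k = sym (count-reindex _ _ (_+ v) (+-cancelʳ v _ _)
    (λ {x} eq → trans (shift x) (trans (cong (_+ k · 1#) eq) (+-identityˡ _)))
    (λ {x} eq → +-cancelʳ (k · 1#) _ _ (trans (sym (shift x)) (trans eq (sym (+-identityˡ _))))))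
    where
    v = proj₁ (trace-surjective 1≤m k)
    shift : ∀ x → trace (x + v) ≡ trace x + k · 1#
    shift x = trans (trace-+ x v) (cong (_+_ (trace x)) (proj₂ (trace-surjective 1≤m k)))

  -- Since p = 1 + 2 (p / 2), a vanishing 2 would turn `p · 1# ≡ 0#` into 1 = 0.
  2≢0 : p % 2 ≡ 1 → 1# + 1# ≢ 0#
  2≢0 p-odd 2≡0 = 0≢1 (begin
    0#                         ≡⟨ p·1≡0 ⟨
    p · 1#                     ≡⟨ cong (_· 1#) (trans (m≡m%n+[m/n]*n p 2) (cong (ℕ._+ (p ℕ./ 2) * 2) p-odd)) ⟩
    1# + ((p ℕ./ 2) * 2) · 1#  ≡⟨ cong (_+_ 1#) (×1-homo-* (p ℕ./ 2) 2) ⟩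
    1# + (p ℕ./ 2) · 1# ⋆ (1# + (1# + 0#)) ≡⟨ cong (λ z → 1# + (p ℕ./ 2) · 1# ⋆ (1# + z)) (+-identityʳ 1#) ⟩
    1# + (p ℕ./ 2) · 1# ⋆ (1# + 1#) ≡⟨ cong (λ z → 1# + (p ℕ./ 2) · 1# ⋆ z) 2≡0 ⟩
    1# + (p ℕ./ 2) · 1# ⋆ 0#   ≡⟨ trans (cong (_+_ 1#) (zeroʳ _)) (+-identityʳ 1#) ⟩
    1#                         ∎)

  -- Power maps

  -- The ratio z of two nonzero elements with equal s-th powers has z^s = z^(q-1) = 1, and
  -- coprimality of the exponents gives z = 1.
  power-injective : ∀ {s} → 1 ≤ s → gcd s (p ^ m ∸ 1) ≡ 1 → Injective _≡_ _≡_ (_↑ s)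
  power-injective {s} 1≤s coprime {x} {y} eq with x ≟ 0# | y ≟ 0#
  ... | yes refl | yes refl = refl
  ... | yes refl | no y≢0   = contradiction (trans (sym eq) (0^n≡0 (ℕ.>⇒≢ 1≤s))) (^-≢0 s y≢0)
  ... | no x≢0   | yes refl = contradiction (trans eq (0^n≡0 (ℕ.>⇒≢ 1≤s))) (^-≢0 s x≢0)
  ... | no x≢0   | no y≢0   = begin
    x                 ≡⟨ *-identityʳ x ⟨
    x ⋆ 1#            ≡⟨ cong (x ⋆_) (trans (*-comm _ _) (⁻¹-inverseʳ y≢0)) ⟨
    x ⋆ (y ⁻¹ ⋆ y)    ≡⟨ *-assoc _ _ _ ⟨
    z ⋆ y             ≡⟨ cong (_⋆ y) z≡1 ⟩
    1# ⋆ y            ≡⟨ *-identityˡ y ⟩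
    y                 ∎
    where
    z = x ⋆ y ⁻¹
    N = p ^ m ∸ 1
    kill : ∀ {a} b → z ↑ a ≡ 1# → z ↑ (b * a) ≡ 1#
    kill {a} b z^a≡1 = trans (cong (z ↑_) (ℕ.*-comm b a)) (trans (sym (^-assocʳ z a b)) (trans (cong (_↑ b) z^a≡1) (1^n≡1 b)))
    z^s≡1 : z ↑ s ≡ 1#
    z^s≡1 = begin
      z ↑ s              ≡⟨ ^-distrib-* x (y ⁻¹) s ⟩
      x ↑ s ⋆ y ⁻¹ ↑ s   ≡⟨ cong (_⋆ y ⁻¹ ↑ s) eq ⟩
      y ↑ s ⋆ y ⁻¹ ↑ s   ≡⟨ ^-distrib-* y (y ⁻¹) s ⟨
      (y ⋆ y ⁻¹) ↑ s     ≡⟨ cong (_↑ s) (⁻¹-inverseʳ y≢0) ⟩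
      1# ↑ s             ≡⟨ 1^n≡1 s ⟩
      1#                 ∎
    z^N≡1 : z ↑ N ≡ 1#
    z^N≡1 = x^[q-1]≡1 (*-≢0 x≢0 (⁻¹-≢0 y≢0))
    -- Over ℕ the Bézout identity says that 1 plus a multiple of one exponent is a multiple of the
    -- other, in either order.
    finish : ∀ {a b} → 1 ℕ.+ a ≡ b → z ↑ a ≡ 1# → z ↑ b ≡ 1# → z ≡ 1#
    finish {a} refl z^a z^b = trans (sym (*-identityʳ z)) (trans (cong (z ⋆_) (sym z^a)) z^b)
    bézout : Bézout.Identity 1 s N → z ≡ 1#
    bézout (Bézout.+- a b e) = finish e (kill b z^N≡1) (kill a z^s≡1)
    bézout (Bézout.-+ a b e) = finish e (kill a z^s≡1) (kill b z^N≡1)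
    z≡1 : z ≡ 1#
    z≡1 = bézout (subst (λ d → Bézout.Identity d s N) coprime (Bézout.identity (gcd-GCD s N)))

  -- One factor `y`, present as 1 ≤ `a`, is set aside to absorb every `y ↑ (Q ∸ 1)`; this needs no
  -- division and covers `y` = `0#`.
  fixed-power-∸ : ∀ {Q y} → 1 ≤ Q → y ↑ Q ≡ y → ∀ {a b} → a ≤ b → 1 ≤ a → Q ∸ 1 ∣ b ∸ a → y ↑ b ≡ y ↑ a
  fixed-power-∸ {Q} {y} 1≤Q fy {suc a} {b} a≤b _ (divides c eq) = begin
    y ↑ b                             ≡⟨ cong (y ↑_) (trans (sym (ℕ.m+[n∸m]≡n a≤b)) (cong (suc a ℕ.+_) eq)) ⟩
    y ↑ (suc a ℕ.+ c * (Q ∸ 1))       ≡⟨ ^-homo-* y (suc a) _ ⟩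
    y ⋆ y ↑ a ⋆ y ↑ (c * (Q ∸ 1))     ≡⟨ solve 3 (λ y u v → y :* u :* v := u :* (y :* v)) refl y _ _ ⟩
    y ↑ a ⋆ (y ⋆ y ↑ (c * (Q ∸ 1)))   ≡⟨ cong (y ↑ a ⋆_) (absorb c) ⟩
    y ↑ a ⋆ y                         ≡⟨ *-comm _ _ ⟩
    y ↑ suc a                         ∎
    where
    absorb : ∀ c → y ⋆ y ↑ (c * (Q ∸ 1)) ≡ y
    absorb zero    = *-identityʳ y
    absorb (suc c) = begin
      y ⋆ y ↑ (Q ∸ 1 ℕ.+ c * (Q ∸ 1))          ≡⟨ cong (y ⋆_) (^-homo-* y (Q ∸ 1) _) ⟩
      y ⋆ (y ↑ (Q ∸ 1) ⋆ y ↑ (c * (Q ∸ 1)))    ≡⟨ *-assoc _ _ _ ⟨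
      y ↑ (1 ℕ.+ (Q ∸ 1)) ⋆ y ↑ (c * (Q ∸ 1))  ≡⟨ cong (λ e → y ↑ e ⋆ y ↑ (c * (Q ∸ 1))) (ℕ.m+[n∸m]≡n 1≤Q) ⟩
      y ↑ Q ⋆ y ↑ (c * (Q ∸ 1))                ≡⟨ cong (_⋆ y ↑ (c * (Q ∸ 1))) fy ⟩
      y ⋆ y ↑ (c * (Q ∸ 1))                    ≡⟨ absorb c ⟩
      y                                        ∎

  fixed-power-≡ : ∀ {Q y} → 1 ≤ Q → y ↑ Q ≡ y → ∀ {a b} → 1 ≤ a → 1 ≤ b → a ≡ b [mod (Q ∸ 1) ] → y ↑ a ≡ y ↑ b
  fixed-power-≡ {Q} {y} 1≤Q fy {a} {b} 1≤a 1≤b a≡b with ℕ.≤-total a b | subst (λ i → Q ∸ 1 ∣ ℤ.∣ i ∣) (ℤ.[+m]-[+n]≡m⊖n a b) a≡b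
  ... | inj₁ a≤b | d = sym (fixed-power-∸ 1≤Q fy a≤b 1≤a (subst (Q ∸ 1 ∣_) (ℤ.∣⊖∣-≤ a≤b) d))
  ... | inj₂ b≤a | d = fixed-power-∸ 1≤Q fy b≤a 1≤b (subst (Q ∸ 1 ∣_) (trans (ℤ.∣m⊖n∣≡∣n⊖m∣ a b) (ℤ.∣⊖∣-≤ b≤a)) d)

-- The quadratic extension and its conjugation

module QuadraticExtension {p n} (p-prime : Prime p) (p-odd : p % 2 ≡ 1) (1≤n : 1 ≤ n) (F : FiniteField (p ^ (2 * n))) where

  open FieldProperties F hiding (_*_; _^_)
  open FieldProperties F using () renaming (_*_ to infixl 7 _⋆_; _^_ to infixr 8 _↑_)
  open PrimePowerField {p} {2 * n} p-prime F
  private module F = FiniteField F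
  open ≡-Reasoning

  Q : ℕ
  Q = p ^ n

  σ : Fin (p ^ (2 * n)) → Fin (p ^ (2 * n))
  σ x = x ↑ Q

  Q*p^i≡p^[n+i] : ∀ i → Q * p ^ i ≡ p ^ (n ℕ.+ i)
  Q*p^i≡p^[n+i] i = sym (ℕ.^-distribˡ-+-* p n i)

  σ-involutive : ∀ x → σ (σ x) ≡ x
  σ-involutive x = begin
    (x ↑ Q) ↑ Q           ≡⟨ ^-assocʳ x Q Q ⟩
    x ↑ (Q * Q)           ≡⟨ cong (x ↑_) (trans (Q*p^i≡p^[n+i] n) (cong (λ k → p ^ (n ℕ.+ k)) (sym (ℕ.+-identityʳ n)))) ⟩
    x ↑ (p ^ (2 * n))     ≡⟨ x^q≡x x ⟩
    x                     ∎

  -- The polynomial x^Q - x is monic of degree Q, less than the order of the field, so it does not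
  -- vanish identically.
  σ-nontrivial : ∃ λ x → σ x ≢ x
  σ-nontrivial = proj₁ nonroot , λ eq → proj₂ nonroot (trans (cong (λ z → z + - 1# ⋆ (x ↑ 1)) eq)
    (trans (cong (λ z → x + - 1# ⋆ z) (*-identityʳ x)) (trans (cong (_+_ x) (-1*x≈-x x)) (-‿inverseʳ x))))
    where
    open import Algebra.Properties.Ring ring using (-1*x≈-x)
    Q<q : Q ℕ.< p ^ (2 * n)
    Q<q = ℕ.^-monoʳ-< p 1<p (ℕ.m<m+n n (ℕ.≤-trans 1≤n (ℕ.m≤m+n n 0)))
    1<Q : 1 ℕ.< Q
    1<Q = ℕ.^-monoʳ-< p 1<p 1≤n
    nonroot : ∃ λ x → x ↑ Q + - 1# ⋆ (x ↑ 1) ≢ 0#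
    nonroot = polynomial-nonzero Q<q
      (polynomial-+ Q (polynomial-^ Q) (polynomial-≤ 1<Q (polynomial-scale 1 (- 1#) (polynomial-^ 1))))
      (λ 1+0≡0 → 0≢1 (trans (sym 1+0≡0) (+-identityʳ 1#)))
    x = proj₁ nonroot

  open FieldWithInvolution.Involution F σ (frobeniusⁱ-+ n) (λ x y → ^-distrib-* x y Q) σ-involutive
    (proj₁ σ-nontrivial) (proj₂ σ-nontrivial) (2≢0 p-odd)

  -- Transitivity of the trace: the terms with indices `i` and `n + i` combine, the latter being
  -- `σ x ↑ (p ^ i)`.
  trace-T : ∀ x → trace x ≡ sumUpTo n (λ i → T x ↑ (p ^ i))
  trace-T x = begin
    sumUpTo (n ℕ.+ (n ℕ.+ 0)) f                       ≡⟨ cong (λ k → sumUpTo (n ℕ.+ k) f) (ℕ.+-identityʳ n) ⟩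
    sumUpTo (n ℕ.+ n) f                               ≡⟨ sumUpTo-append n n f ⟩
    sumUpTo n f + sumUpTo n (λ i → f (n ℕ.+ i))       ≡⟨ sumUpTo-+ n f _ ⟨
    sumUpTo n (λ i → f i + f (n ℕ.+ i))               ≡⟨ sumUpTo-cong n (λ i → cong (_+_ (f i)) (trans (cong (x ↑_) (sym (Q*p^i≡p^[n+i] i))) (sym (^-assocʳ x Q (p ^ i))))) ⟩
    sumUpTo n (λ i → f i + σ x ↑ (p ^ i))             ≡⟨ sumUpTo-cong n (λ i → frobeniusⁱ-+ i x (σ x)) ⟨
    sumUpTo n (λ i → T x ↑ (p ^ i))                   ∎
    where
    f : ℕ → Fin (p ^ (2 * n))
    f i = x ↑ (p ^ i)

  -- Niho exponents and the vanishing Weil sum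

  module Niho {s} (1≤s : 1 ≤ s) (invertible : IsInvertible p n s) (j : ℕ) (s≡p^j : s ≡ p ^ j [mod (p ^ n ∸ 1) ]) where

    -- Since j + (n - 1) j = n j, this twist of x^s is linear over the fixed field of σ.
    g : Fin (p ^ (2 * n)) → Fin (p ^ (2 * n))
    g x = (x ↑ s) ↑ (p ^ ((n ∸ 1) * j))

    g-injective : Injective _≡_ _≡_ g
    g-injective eq = power-injective 1≤s invertible (frobeniusⁱ-injective ((n ∸ 1) * j) eq)

    p^i≥1 : ∀ i → 1 ≤ p ^ i
    p^i≥1 = ℕ.m^n>0 p {{prime⇒nonZero p-prime}}

    g-homogeneous : ∀ {y} → Fixed y → ∀ x → g (y ⋆ x) ≡ y ⋆ g x
    g-homogeneous {y} fy x = begin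
      ((y ⋆ x) ↑ s) ↑ k     ≡⟨ cong (_↑ k) (^-distrib-* y x s) ⟩
      (y ↑ s ⋆ x ↑ s) ↑ k   ≡⟨ ^-distrib-* _ _ k ⟩
      (y ↑ s) ↑ k ⋆ g x     ≡⟨ cong (λ z → z ↑ k ⋆ g x) (fixed-power-≡ (p^i≥1 n) fy 1≤s (p^i≥1 j) s≡p^j) ⟩
      (y ↑ (p ^ j)) ↑ k ⋆ g x ≡⟨ cong (_⋆ g x) (trans (^-assocʳ y (p ^ j) k) (trans (cong (y ↑_) exponent) (fixed-iterate j))) ⟩
      y ⋆ g x               ∎
      where
      k = p ^ ((n ∸ 1) * j)
      exponent : p ^ j * k ≡ Q ^ j
      exponent = trans (sym (ℕ.^-distribˡ-+-* p j _))
        (trans (cong (λ i → p ^ (i * j)) (ℕ.m+[n∸m]≡n 1≤n)) (sym (ℕ.^-*-assoc p n j)))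
      fixed-iterate : ∀ i → y ↑ (Q ^ i) ≡ y
      fixed-iterate zero    = *-identityʳ y
      fixed-iterate (suc i) = trans (sym (^-assocʳ y Q (Q ^ i))) (trans (cong (_↑ (Q ^ i)) fy) (fixed-iterate i))

    open Kakeya g g-injective g-homogeneous using (T-reparametrization)

    singular : ∃ λ a → a ≢ 0# × WeilZero F p (2 * n) s a
    singular = from T-reparametrization
      where
      from : (∃ λ b → b ≢ 0# × ∃ λ Ψ → Injective _≡_ _≡_ Ψ × (∀ w → T (g w - b ⋆ w) ≡ T (Ψ w))) →
        ∃ λ a → a ≢ 0# × WeilZero F p (2 * n) s a
      -- The common coefficient is the number of elements of trace 0: `Ψ` matches the solutions
      -- counted by coefficient `k` with the elements of trace `k · 1#`.
      from (b , b≢0 , Ψ , Ψ-injective , T≡TΨ) = b , b≢0 , length (filter (λ x → trace x ≟ 0#) (allFin _)) , λ k _ →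
        trans (count-reindex _ (λ x → trace x ≟ k · 1#) Ψ Ψ-injective
          (λ {x} eq → trans (sym (Tr≡traceΨ x)) (trans eq (natF-agrees k)))
          (λ {x} eq → trans (Tr≡traceΨ x) (trans eq (sym (natF-agrees k)))))
        (trace-equidistributed (ℕ.≤-trans 1≤n (ℕ.m≤m+n n _)) k)
        where
        Tr≡traceΨ : ∀ x → Tr F p (2 * n) ((x F.^ s) F.- (b F.* x)) ≡ trace (Ψ x)
        Tr≡traceΨ x = begin
          Tr F p (2 * n) ((x F.^ s) F.- (b F.* x)) ≡⟨ Tr≡trace _ ⟩
          trace (x F.^ s - b ⋆ x)                  ≡⟨ cong (λ z → trace (z - b ⋆ x)) (^-agrees x s) ⟩
          trace (x ↑ s - b ⋆ x)                    ≡⟨ trace-+ _ _ ⟩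
          -- The Frobenius power that turns `x ↑ s` into `g x` does not change the trace.
          trace (x ↑ s) + trace (- (b ⋆ x))        ≡⟨ cong (_+ trace (- (b ⋆ x))) (trace-frobeniusⁱ ((n ∸ 1) * j) (x ↑ s)) ⟨
          trace (g x) + trace (- (b ⋆ x))          ≡⟨ trace-+ _ _ ⟨
          trace (g x - b ⋆ x)                      ≡⟨ trace-T _ ⟩
          sumUpTo n (λ i → T (g x - b ⋆ x) ↑ (p ^ i)) ≡⟨ sumUpTo-cong n (λ i → cong (_↑ (p ^ i)) (T≡TΨ x)) ⟩
          sumUpTo n (λ i → T (Ψ x) ↑ (p ^ i))      ≡⟨ trace-T _ ⟨
          trace (Ψ x)                              ∎

theorem1p6 : (p n s : ℕ) → Prime p → p % 2 ≡ 1 → 1 ≤ n → 1 ≤ s →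
    (L : FiniteField (p ^ (2 * n))) →
    IsInvertible p n s → IsNiho p n s →
    ∃ λ a → (a ≢ FiniteField.0# L) × WeilZero L p (2 * n) s a
theorem1p6 p n s p-prime p-odd 1≤n 1≤s L invertible (_ , j , s≡p^j) =
  QuadraticExtension.Niho.singular {p} {n} p-prime p-odd 1≤n L 1≤s invertible j s≡p^j
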